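{- Let $(P_n(x))_{n\ge0}$ be a sequence of polynomials such that $\sum_{n\ge0}P_n(x)\frac{t^n}{n!}=f(t)e^{xt}$ for some $f$ holomorphic at $0$ with $f(0)\neq0$, and such that $P_n(1-x)=(-1)^nP_n(x)$ for all $n\ge0$. Let $N$ be a positive integer. If the function $F(t)=f(t)-\sum_{k=0}^{N}E_k(0)\frac{t^k}{k!}$ is odd, then $P_n(x)=E_n(x)$ for all $n\ge0$ and $f(t)=\frac{2}{e^t+1}$.
   Context: $E_n(x)$ denotes the Euler polynomials, defined by $\sum_{n\ge0}E_n(x)\frac{t^n}{n!}=\frac{2e^{xt}}{e^t+1}$. -}

module Defs where

open import Level using (_⊔_) renaming (suc to lsuc)
open import Algebra.Bundles using (CommutativeRing; RawRing; RawSemiring)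
open import Algebra.Apartness.Bundles using (HeytingField)
open import Data.List.Base using (List; []; _∷_)
open import Data.Nat.Base as ℕ using (ℕ; zero; suc; z≤n; s≤s)
import Data.Nat.Properties as ℕ
open import Data.Product.Base using (Σ; ∃; _×_; _,_; proj₁; proj₂)
open import Data.Sum.Base using (_⊎_; inj₁; inj₂)
open import Data.Empty using (⊥-elim)
open import Relation.Binary.Core using (Rel)
open import Relation.Binary.Structures using (IsStrictPartialOrder)
open import Relation.Nullary.Negation using (¬_)
import Relation.Binary.PropositionalEquality.Core as ≡
import Algebra.Definitions.RawSemiring as RawSemiringDefs
import Algebra.Properties.Ring as RingProperties
import Algebra.Apartness.Properties.HeytingCommutativeRing as HeytingProperties
import Algebra.Properties.CommutativeMonoid.Mult as MultProperties
import Algebra.Solver.Ring.NaturalCoefficients.Default as NatSolver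
import Relation.Binary.Reasoning.Setoid as SetoidReasoning

-- The real numbers, axiomatised as a Cauchy complete Archimedean ordered field
-- (unique up to isomorphism, classically).
record RealField c ℓ₁ ℓ₂ ℓ₃ : Set (lsuc (c ⊔ ℓ₁ ⊔ ℓ₂ ⊔ ℓ₃)) where
  field
    heytingField : HeytingField c ℓ₁ ℓ₂

  open HeytingField heytingField public

  commutativeRing : CommutativeRing c ℓ₁
  commutativeRing = record { isCommutativeRing = isCommutativeRing }

  open RawSemiringDefs
    (RawRing.rawSemiring (CommutativeRing.rawRing commutativeRing)) public
    using (_^_) renaming (_×_ to _·_)

  infix 4 _<_ _≤_

  field
    _<_                  : Rel Carrier ℓ₃
    isStrictPartialOrder : IsStrictPartialOrder _≈_ _<_
    <⇒#                  : ∀ {x y} → x < y → x # y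
    #⇒<⊎>                : ∀ {x y} → x # y → (x < y) ⊎ (y < x)
    +-monoˡ-<            : ∀ z {x y} → x < y → x + z < y + z
    *-pos                : ∀ {x y} → 0# < x → 0# < y → 0# < x * y
    archimedean          : ∀ x {ε} → 0# < ε → ∃ λ n → x < n · ε

  _≤_ : Rel Carrier ℓ₃
  x ≤ y = ¬ (y < x)

  -- |x - y| < ε
  Within : Carrier → Carrier → Carrier → Set ℓ₃
  Within ε x y = (x < y + ε) × (y < x + ε)

  Cauchy : (ℕ → Carrier) → Set (c ⊔ ℓ₃)
  Cauchy s = ∀ {ε} → 0# < ε →
    ∃ λ N → ∀ m n → N ℕ.≤ m → N ℕ.≤ n → Within ε (s m) (s n)

  ConvergesTo : (ℕ → Carrier) → Carrier → Set (c ⊔ ℓ₃)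
  ConvergesTo s l = ∀ {ε} → 0# < ε → ∃ λ N → ∀ n → N ℕ.≤ n → Within ε (s n) l

  field
    complete : ∀ s → Cauchy s → ∃ λ l → ConvergesTo s l

module RealProperties {c ℓ₁ ℓ₂ ℓ₃} (R : RealField c ℓ₁ ℓ₂ ℓ₃) where

  open RealField R
  open CommutativeRing commutativeRing
    using (ring; commutativeSemiring; +-commutativeMonoid)
  open RingProperties ring
    using (-‿distribˡ-*; -‿distribʳ-*; -‿involutive; -‿+-comm)
  open HeytingProperties (HeytingField.heytingCommutativeRing heytingField)
    using (1#0; x-0≈x; invertibleˡ⇒#)
  open IsStrictPartialOrder isStrictPartialOrder public
    using () renaming (irrefl to <-irrefl; trans to <-trans; asym to <-asym;
                       <-respʳ-≈ to <-respʳ; <-respˡ-≈ to <-respˡ)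
  open NatSolver commutativeSemiring using (solve; _:=_; _:+_; _:*_)

  open MultProperties +-commutativeMonoid using (×-homo-+; ×-distrib-+)

  infix 4 _<≈_
  _<≈_ : ∀ {x y z} → x < y → y ≈ z → x < z
  p <≈ e = <-respʳ e p

  _≈<_ : ∀ {x y z} → x ≈ y → y < z → x < z
  e ≈< p = <-respˡ (sym e) p

  +-cancel-neg : ∀ x y → x + y + - y ≈ x
  +-cancel-neg x y = trans (+-assoc x y (- y))
    (trans (+-congˡ (-‿inverseʳ y)) (+-identityʳ x))

  +-cancel-neg′ : ∀ x y → x + - y + y ≈ x
  +-cancel-neg′ x y = trans (+-assoc x (- y) y)
    (trans (+-congˡ (-‿inverseˡ y)) (+-identityʳ x))

  +-monoʳ-< : ∀ z {x y} → x < y → z + x < z + y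
  +-monoʳ-< z p = +-comm z _ ≈< +-monoˡ-< z p <≈ +-comm _ z

  +-cancelʳ-< : ∀ z {x y} → x + z < y + z → x < y
  +-cancelʳ-< z {x} {y} p =
    sym (+-cancel-neg x z) ≈< +-monoˡ-< (- z) p <≈ +-cancel-neg y z

  <⇒0<- : ∀ {x y} → x < y → 0# < y + - x
  <⇒0<- {x} p = sym (-‿inverseʳ x) ≈< +-monoˡ-< (- x) p

  0<-⇒< : ∀ {x y} → 0# < y + - x → x < y
  0<-⇒< {x} {y} p =
    sym (+-identityˡ x) ≈< +-monoˡ-< x p <≈ +-cancel-neg′ y x

  neg-pos : ∀ {x} → x < 0# → 0# < - x
  neg-pos p = <⇒0<- p <≈ +-identityˡ _

  <-cotrans : ∀ {x y} → x < y → ∀ z → (x < z) ⊎ (z < y)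
  <-cotrans {x} {y} p z with #-cotrans (<⇒# p) z
  ... | inj₁ x#z with #⇒<⊎> x#z
  ...   | inj₁ x<z = inj₁ x<z
  ...   | inj₂ z<x = inj₂ (<-trans z<x p)
  <-cotrans {x} {y} p z | inj₂ z#y with #⇒<⊎> z#y
  ...   | inj₁ z<y = inj₂ z<y
  ...   | inj₂ y<z = inj₁ (<-trans p y<z)

  <⇒≤ : ∀ {x y} → x < y → x ≤ y
  <⇒≤ p q = <-asym p q

  ≤-reflexive : ∀ {x y} → x ≈ y → x ≤ y
  ≤-reflexive e q = <-irrefl (sym e) q

  ≤-refl : ∀ {x} → x ≤ x
  ≤-refl = ≤-reflexive refl

  ≤-<-trans : ∀ {x y z} → x ≤ y → y < z → x < z
  ≤-<-trans {x} p q with <-cotrans q x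
  ... | inj₁ y<x = ⊥-elim (p y<x)
  ... | inj₂ x<z = x<z

  <-≤-trans : ∀ {x y z} → x < y → y ≤ z → x < z
  <-≤-trans {z = z} p q with <-cotrans p z
  ... | inj₁ x<z = x<z
  ... | inj₂ z<y = ⊥-elim (q z<y)

  ≤-trans : ∀ {x y z} → x ≤ y → y ≤ z → x ≤ z
  ≤-trans p q z<x = p (≤-<-trans q z<x)

  infix 4 _≤≈_
  _≤≈_ : ∀ {x y z} → x ≤ y → y ≈ z → x ≤ z
  p ≤≈ e = ≤-trans p (≤-reflexive e)

  _≈≤_ : ∀ {x y z} → x ≈ y → y ≤ z → x ≤ z
  e ≈≤ p = ≤-trans (≤-reflexive e) p

  +-monoˡ-≤ : ∀ z {x y} → x ≤ y → x + z ≤ y + z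
  +-monoˡ-≤ z p q = p (+-cancelʳ-< z q)

  +-monoʳ-≤ : ∀ z {x y} → x ≤ y → z + x ≤ z + y
  +-monoʳ-≤ z p = +-comm z _ ≈≤ +-monoˡ-≤ z p ≤≈ +-comm _ z

  +-mono-≤ : ∀ {x y u v} → x ≤ y → u ≤ v → x + u ≤ y + v
  +-mono-≤ p q = ≤-trans (+-monoˡ-≤ _ p) (+-monoʳ-≤ _ q)

  ≤⇒0≤- : ∀ {x y} → x ≤ y → 0# ≤ y + - x
  ≤⇒0≤- {x} p = sym (-‿inverseʳ x) ≈≤ +-monoˡ-≤ (- x) p

  0≤-⇒≤ : ∀ {x y} → 0# ≤ y + - x → x ≤ y
  0≤-⇒≤ {x} {y} p = sym (+-identityˡ x) ≈≤ +-monoˡ-≤ x p ≤≈ +-cancel-neg′ y x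

  0<1 : 0# < 1#
  0<1 with #⇒<⊎> 1#0
  ... | inj₂ p = p
  ... | inj₁ p = *-pos (neg-pos p) (neg-pos p) <≈ e
    where
    e : - 1# * - 1# ≈ 1#
    e = trans (sym (-‿distribˡ-* 1# (- 1#)))
          (trans (-‿cong (*-identityˡ (- 1#))) (-‿involutive 1#))

  recip : ∀ x → x # 0# → Carrier
  recip x x#0 = proj₁ (#⇒invertible x#0)

  recip-inverseʳ : ∀ x (x#0 : x # 0#) → x * recip x x#0 ≈ 1#
  recip-inverseʳ x x#0 =
    trans (*-congʳ (sym (x-0≈x x))) (proj₂ (proj₂ (#⇒invertible x#0)))

  0<⇒#0 : ∀ {x} → 0# < x → x # 0#
  0<⇒#0 p = #-sym (<⇒# p)

  neg*pos : ∀ {x y} → x < 0# → 0# < y → x * y < 0#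
  neg*pos {x} {y} p q = 0<-⇒< (*-pos (neg-pos p) q <≈
    trans (sym (-‿distribˡ-* x y)) (sym (+-identityˡ _)))

  *-cancel-pos : ∀ {x y} → 0# < y → 0# < x * y → 0# < x
  *-cancel-pos {x} {y} q p with #⇒<⊎> x#0
    where
    z = recip (x * y) (0<⇒#0 p)
    x#0 : x # 0#
    x#0 = invertibleˡ⇒# (y * z , trans (*-comm _ _)
      (trans (*-congʳ (x-0≈x x)) (trans (sym (*-assoc x y z))
      (recip-inverseʳ (x * y) (0<⇒#0 p)))))
  ... | inj₂ r = r
  ... | inj₁ r = ⊥-elim (<-asym p (neg*pos r q))

  recip-pos : ∀ {x} (p : 0# < x) → 0# < recip x (0<⇒#0 p)
  recip-pos {x} p = *-cancel-pos p
    (0<1 <≈ trans (sym (recip-inverseʳ x (0<⇒#0 p))) (*-comm _ _))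

  *-nonneg : ∀ {x y} → 0# ≤ x → 0# ≤ y → 0# ≤ x * y
  *-nonneg {x} {y} p q r = x≉0 (proj₁ (tight x 0#) ¬x#0)
    where
    x≉0 : ¬ (x ≈ 0#)
    x≉0 e = <-irrefl (trans (*-congʳ e) (zeroˡ y)) r
    ¬x#0 : ¬ (x # 0#)
    ¬x#0 x#0 with #⇒<⊎> x#0
    ... | inj₁ x<0 = p x<0
    ... | inj₂ 0<x = q (0<-⇒< (*-cancel-pos 0<x (neg-pos r <≈
            trans (-‿distribʳ-* x y) (*-comm x (- y))) <≈ sym (+-identityˡ _)))

  *-monoˡ-≤ : ∀ {z} → 0# ≤ z → ∀ {x y} → x ≤ y → x * z ≤ y * z
  *-monoˡ-≤ {z} p {x} {y} q = 0≤-⇒≤ (*-nonneg (≤⇒0≤- q) p ≤≈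
    trans (distribʳ z y (- x)) (+-congˡ (sym (-‿distribˡ-* x z))))

  *-monoʳ-≤ : ∀ {z} → 0# ≤ z → ∀ {x y} → x ≤ y → z * x ≤ z * y
  *-monoʳ-≤ p q = *-comm _ _ ≈≤ *-monoˡ-≤ p q ≤≈ *-comm _ _

  ·-mono-≤ : ∀ n {x y} → x ≤ y → n · x ≤ n · y
  ·-mono-≤ zero    p = ≤-refl
  ·-mono-≤ (suc n) p = +-mono-≤ p (·-mono-≤ n p)

  ·-nonneg : ∀ n {x} → 0# ≤ x → 0# ≤ n · x
  ·-nonneg zero    p = ≤-refl
  ·-nonneg (suc n) p = sym (+-identityˡ 0#) ≈≤ +-mono-≤ p (·-nonneg n p)

  ·-monoˡ-≤ : ∀ {m n x} → 0# ≤ x → m ℕ.≤ n → m · x ≤ n · x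
  ·-monoˡ-≤ {n = n} p z≤n       = ·-nonneg n p
  ·-monoˡ-≤         p (s≤s m≤n) = +-monoʳ-≤ _ (·-monoˡ-≤ p m≤n)

  ·-pos : ∀ n {x} → 0# < x → 0# < suc n · x
  ·-pos n p = <-≤-trans p (sym (+-identityʳ _) ≈≤
    +-monoʳ-≤ _ (·-nonneg n (<⇒≤ p)))

  -- |x| ≤ b
  Bounded : Carrier → Carrier → Set ℓ₃
  Bounded x b = (x ≤ b) × (- x ≤ b)

  neg-bounded : ∀ {x b} → Bounded x b → Bounded (- x) b
  neg-bounded (p , q) = q , (-‿involutive _ ≈≤ p)

  +-bounded : ∀ {x y b d} → Bounded x b → Bounded y d → Bounded (x + y) (b + d)
  +-bounded (p , q) (p′ , q′) =
    +-mono-≤ p p′ , (sym (-‿+-comm _ _) ≈≤ +-mono-≤ q q′)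

  weaken : ∀ {x b d} → Bounded x b → b ≤ d → Bounded x d
  weaken (p , q) r = ≤-trans p r , ≤-trans q r

  half-nonneg : ∀ {x} → 0# ≤ x + x → 0# ≤ x
  half-nonneg p q = p (<-trans (+-monoˡ-< _ q <≈ +-identityˡ _) q)

  neg-+ : ∀ {x b} → - x ≤ b → 0# ≤ b + x
  neg-+ p = ≤⇒0≤- p ≤≈ +-congˡ (-‿involutive _)

  *-bound : ∀ {x y b d} → Bounded x b → Bounded y d → x * y ≤ b * d
  *-bound {x} {y} {b} {d} (p , q) (p′ , q′) = 0≤-⇒≤ (half-nonneg
    ((sym (+-identityˡ 0#)) ≈≤ +-mono-≤ (*-nonneg (≤⇒0≤- p) (neg-+ q′))
       (*-nonneg (neg-+ q) (≤⇒0≤- p′)) ≤≈ eq))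
    where
    open SetoidReasoning setoid
    eq : (b + - x) * (d + y) + (b + x) * (d + - y)
       ≈ (b * d + - (x * y)) + (b * d + - (x * y))
    eq = begin
      (b + - x) * (d + y) + (b + x) * (d + - y)
        ≈⟨ solve 6 (λ b x -x d y -y →
             (b :+ -x) :* (d :+ y) :+ (b :+ x) :* (d :+ -y)
             := b :* d :+ -x :* y :+ (b :* d :+ x :* -y)
                :+ (b :* (y :+ -y) :+ d :* (x :+ -x))) refl b x (- x) d y (- y) ⟩
      b * d + - x * y + (b * d + x * - y) + (b * (y + - y) + d * (x + - x))
        ≈⟨ +-congˡ (+-cong (trans (*-congˡ (-‿inverseʳ y)) (zeroʳ b))
                           (trans (*-congˡ (-‿inverseʳ x)) (zeroʳ d))) ⟩
      b * d + - x * y + (b * d + x * - y) + (0# + 0#)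
        ≈⟨ trans (+-congˡ (+-identityʳ 0#)) (+-identityʳ _) ⟩
      b * d + - x * y + (b * d + x * - y)
        ≈⟨ +-cong (+-congˡ (sym (-‿distribˡ-* x y)))
                  (+-congˡ (sym (-‿distribʳ-* x y))) ⟩
      (b * d + - (x * y)) + (b * d + - (x * y)) ∎

  *-bounded : ∀ {x y b d} → Bounded x b → Bounded y d → Bounded (x * y) (b * d)
  *-bounded p q =
    *-bound p q , (-‿distribˡ-* _ _ ≈≤ *-bound (neg-bounded p) q)

  pos-bounded : ∀ {x} → 0# < x → Bounded x x
  pos-bounded {x} p = ≤-refl , <⇒≤ (<-trans
    (sym (+-identityˡ (- x)) ≈< (+-monoˡ-< (- x) p <≈ -‿inverseʳ x)) p)

  -x*-x : ∀ x → - x * - x ≈ x * x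
  -x*-x x = trans (sym (-‿distribˡ-* x (- x)))
    (trans (-‿cong (sym (-‿distribʳ-* x x))) (-‿involutive _))

  halving-bound : ∀ (d : ℕ → Carrier) → (∀ n → 0# ≤ d n) →
    (∀ n → d (suc n) + d (suc n) ≤ d n) → ∀ n → suc n · d n ≤ d 0
  halving-bound d d≥0 d-half zero    = ≤-reflexive (+-identityʳ (d 0))
  halving-bound d d≥0 d-half (suc n) =
    ≤-trans (·-monoˡ-≤ (d≥0 (suc n)) (s≤s (ℕ.m≤n+m (suc n) n)))
      (×-homo-+ (d (suc n)) (suc n) (suc n) ≈≤
       (sym (×-distrib-+ (d (suc n)) (d (suc n)) (suc n)) ≈≤
       ≤-trans (·-mono-≤ (suc n) (d-half n)) (halving-bound d d≥0 d-half n)))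

  halving-small : ∀ (d : ℕ → Carrier) → (∀ n → 0# ≤ d n) →
    (∀ n → d (suc n) + d (suc n) ≤ d n) → ∀ {ε} → 0# < ε → ∃ λ n → d n < ε
  halving-small d d≥0 d-half {ε} ε>0 with archimedean (d 0) ε>0
  ... | n , d0<nε with <-cotrans (<-≤-trans d0<nε (·-monoˡ-≤ (<⇒≤ ε>0) (ℕ.n≤1+n n))) (suc n · d n)
  ...   | inj₁ p = ⊥-elim (halving-bound d d≥0 d-half n p)
  ...   | inj₂ p = n , ·-cancel-< (suc n) p
    where
    ·-cancel-< : ∀ m {x y} → m · x < m · y → x < y
    ·-cancel-< zero    q = ⊥-elim (<-irrefl refl q)
    ·-cancel-< (suc m) {x} {y} q with <-cotrans q (y + m · x)
    ... | inj₁ r = +-cancelʳ-< (m · x) r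
    ... | inj₂ r = ·-cancel-< m (+-cancelʳ-< y (+-comm _ _ ≈< r <≈ +-comm _ _))

  -- A series whose terms are eventually dominated by a halving sequence.
  halving⇒cauchy : ∀ (S a b : ℕ → Carrier) K → (∀ n → S (suc n) ≈ S n + a n) →
    (∀ n → 0# ≤ b n) → (∀ n → Bounded (a n) (b n)) →
    (∀ n → K ℕ.≤ n → b (suc n) + b (suc n) ≤ b n) → Cauchy S
  halving⇒cauchy S a b K S-suc b≥0 a≤b b-half {ε} ε>0 =
    M , λ m n M≤m M≤n → close M≤m M≤n , close M≤n M≤m
    where
    2b : ℕ → Carrier
    2b n = b n + b n

    +-nonneg : ∀ {x y} → 0# ≤ x → 0# ≤ y → 0# ≤ x + y
    +-nonneg p q = sym (+-identityˡ 0#) ≈≤ +-mono-≤ p q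

    2b≥0 : ∀ n → 0# ≤ 2b n
    2b≥0 n = +-nonneg (b≥0 n) (b≥0 n)

    4b : ℕ → Carrier
    4b j = 2b (j ℕ.+ K) + 2b (j ℕ.+ K)

    4b-half : ∀ j → 4b (suc j) + 4b (suc j) ≤ 4b j
    4b-half j = +-mono-≤ (+-mono-≤ h h) (+-mono-≤ h h)
      where h = b-half (j ℕ.+ K) (ℕ.m≤n+m K j)

    small : ∃ λ j → 4b j < ε
    small = halving-small 4b (λ j → +-nonneg (2b≥0 _) (2b≥0 _)) 4b-half ε>0

    M = proj₁ small ℕ.+ K

    K≤ : ∀ i → K ℕ.≤ i ℕ.+ M
    K≤ i = ℕ.≤-trans (ℕ.m≤n+m K (proj₁ small)) (ℕ.m≤n+m M i)

    upper : ∀ i → S (i ℕ.+ M) + 2b (i ℕ.+ M) ≤ S M + 2b M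
    upper zero    = ≤-refl
    upper (suc i) = ≤-trans
      (+-mono-≤ (S-suc k ≈≤ +-monoʳ-≤ (S k) (proj₁ (a≤b k))) (b-half k (K≤ i))
        ≤≈ +-assoc _ _ _)
      (upper i)
      where k = i ℕ.+ M

    lower : ∀ i → S M + 2b (i ℕ.+ M) ≤ S (i ℕ.+ M) + 2b M
    lower zero    = ≤-refl
    lower (suc i) = ≤-trans
      (+-monoʳ-≤ (S M) (b-half k (K≤ i))) (≤-trans
      (sym (+-identityʳ _) ≈≤ +-monoʳ-≤ (S M + b k) (neg-+ (proj₂ (a≤b k))))
      (solve 3 (λ s b a → s :+ b :+ (b :+ a) := s :+ (b :+ b) :+ a) refl
         (S M) (b k) (a k)
        ≈≤ (+-monoˡ-≤ (a k) (lower i)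
        ≤≈ trans (solve 3 (λ x y z → x :+ y :+ z := x :+ z :+ y) refl
                    (S k) (2b M) (a k)) (+-congʳ (sym (S-suc k))))))
      where k = i ℕ.+ M

    drop : ∀ x {y} → 0# ≤ y → x ≤ x + y
    drop x p = sym (+-identityʳ x) ≈≤ +-monoʳ-≤ x p

    close′ : ∀ i k → S (i ℕ.+ M) < S (k ℕ.+ M) + ε
    close′ i k = ≤-<-trans
      (≤-trans (drop _ (2b≥0 (i ℕ.+ M))) (≤-trans (upper i)
        (+-monoˡ-≤ (2b M) (≤-trans (drop _ (2b≥0 (k ℕ.+ M))) (lower k))
          ≤≈ +-assoc _ _ _)))
      (+-monoʳ-< (S (k ℕ.+ M)) (proj₂ small))

    close : ∀ {m n} → M ℕ.≤ m → M ℕ.≤ n → S m < S n + ε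
    close {m} {n} M≤m M≤n = ≡.subst₂ (λ m n → S m < S n + ε)
      (ℕ.m∸n+n≡m M≤m) (ℕ.m∸n+n≡m M≤n) (close′ (m ℕ.∸ M) (n ℕ.∸ M))

  0<n·1 : ∀ n → 0# < suc n · 1#
  0<n·1 n = ·-pos n 0<1

  -- 1/n!
  invFactorial : ℕ → Carrier
  invFactorial zero    = 1#
  invFactorial (suc n) = invFactorial n * recip (suc n · 1#) (0<⇒#0 (0<n·1 n))

  invFactorial-pos : ∀ n → 0# < invFactorial n
  invFactorial-pos zero    = 0<1
  invFactorial-pos (suc n) = *-pos (invFactorial-pos n) (recip-pos (0<n·1 n))

module Complex {c ℓ₁ ℓ₂ ℓ₃} (R : RealField c ℓ₁ ℓ₂ ℓ₃) where

  open RealField R hiding (Carrier; 0#; _<_)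
  open RealField R public using (0#; _<_) renaming (Carrier to ℝ)
  open RealProperties R
  open CommutativeRing commutativeRing
    using (ring; commutativeSemiring; +-commutativeMonoid)
  open MultProperties +-commutativeMonoid using (×-homo-+)

  infix 4 _≈ᶜ_ _#0
  infixl 6 _+ᶜ_ _-ᶜ_
  infixl 7 _*ᶜ_ _•_
  infix 8 -ᶜ_ -ᴰ_

  record ℂ : Set c where
    constructor _+i_
    field
      re im : ℝ

  open ℂ public

  _≈ᶜ_ : Rel ℂ ℓ₁
  z ≈ᶜ w = (re z ≈ re w) × (im z ≈ im w)

  0ᶜ 1ᶜ 2ᶜ : ℂ
  0ᶜ = 0# +i 0#
  1ᶜ = 1# +i 0#
  2ᶜ = (1# + 1#) +i 0#

  _+ᶜ_ _*ᶜ_ _-ᶜ_ : ℂ → ℂ → ℂ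
  z +ᶜ w = (re z + re w) +i (im z + im w)
  z *ᶜ w = (re z * re w - im z * im w) +i (re z * im w + im z * re w)
  z -ᶜ w = (re z - re w) +i (im z - im w)

  -ᶜ_ : ℂ → ℂ
  -ᶜ z = (- re z) +i (- im z)

  _•_ : ℝ → ℂ → ℂ
  a • z = (a * re z) +i (a * im z)

  rawSemiringᶜ : RawSemiring c ℓ₁
  rawSemiringᶜ = record
    { _≈_ = _≈ᶜ_ ; _+_ = _+ᶜ_ ; _*_ = _*ᶜ_ ; 0# = 0ᶜ ; 1# = 1ᶜ }

  open RawSemiringDefs rawSemiringᶜ public using () renaming (_^_ to _^ᶜ_)

  -- |z|²
  normSq : ℂ → ℝ
  normSq z = re z * re z + im z * im z

  -- |z| < r, for r > 0
  ∣_∣<_ : ℂ → ℝ → Set ℓ₃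
  ∣ z ∣< r = normSq z < r * r

  -- Apartness from 0; classically this is z ≠ 0.
  _#0 : ℂ → Set ℓ₂
  z #0 = normSq z # 0#

  inverse : ∀ z → z #0 → ℂ
  inverse z z#0 = recip (normSq z) z#0 • (re z +i (- im z))

  -- Σ_{k < n} a k
  partialSum : (ℕ → ℂ) → ℕ → ℂ
  partialSum a zero    = 0ᶜ
  partialSum a (suc n) = partialSum a n +ᶜ a n

  HasSum : (ℕ → ℂ) → ℂ → Set (c ⊔ ℓ₃)
  HasSum a s = ∀ {ε} → 0# < ε →
    ∃ λ N → ∀ n → N ℕ.≤ n → ∣ partialSum a n -ᶜ s ∣< ε

  -- z ^ n / n!
  powOver! : ℂ → ℕ → ℂ
  powOver! z n = invFactorial n • (z ^ᶜ n)

  -- Convergence of Σ z ^ n / n!: both components of the n-th term are bounded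
  -- by B ^ n / n!, where B = 2k and k bounds both components of z.
  module ExpSeries (z : ℂ) where

    bound : ∃ λ k → Bounded (re z) (k · 1#) × Bounded (im z) (k · 1#)
    bound = k , (below k₁≤ (proj₂ a₁) , below k₂≤ (proj₂ a₂))
              , (below k₃≤ (proj₂ a₃) , below k₄≤ (proj₂ a₄))
      where
      a₁ = archimedean (re z) 0<1
      a₂ = archimedean (- re z) 0<1
      a₃ = archimedean (im z) 0<1
      a₄ = archimedean (- im z) 0<1
      k₁₂ = proj₁ a₁ ℕ.+ proj₁ a₂
      k₃₄ = proj₁ a₃ ℕ.+ proj₁ a₄
      k = k₁₂ ℕ.+ k₃₄
      k₁≤ : proj₁ a₁ ℕ.≤ k
      k₁≤ = ℕ.≤-trans (ℕ.m≤m+n (proj₁ a₁) _) (ℕ.m≤m+n k₁₂ k₃₄)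
      k₂≤ : proj₁ a₂ ℕ.≤ k
      k₂≤ = ℕ.≤-trans (ℕ.m≤n+m (proj₁ a₂) (proj₁ a₁)) (ℕ.m≤m+n k₁₂ k₃₄)
      k₃≤ : proj₁ a₃ ℕ.≤ k
      k₃≤ = ℕ.≤-trans (ℕ.m≤m+n (proj₁ a₃) _) (ℕ.m≤n+m k₃₄ k₁₂)
      k₄≤ : proj₁ a₄ ℕ.≤ k
      k₄≤ = ℕ.≤-trans (ℕ.m≤n+m (proj₁ a₄) (proj₁ a₃)) (ℕ.m≤n+m k₃₄ k₁₂)
      below : ∀ {x i} → i ℕ.≤ k → x < i · 1# → x ≤ k · 1#
      below i≤k p = <⇒≤ (<-≤-trans p (·-monoˡ-≤ (<⇒≤ 0<1) i≤k))

    k K : ℕ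
    k = proj₁ bound
    K = (k ℕ.+ k) ℕ.+ (k ℕ.+ k)

    B : ℝ
    B = (k ℕ.+ k) · 1#

    B^-nonneg : ∀ n → 0# ≤ B ^ n
    B^-nonneg zero    = <⇒≤ 0<1
    B^-nonneg (suc n) = *-nonneg (·-nonneg (k ℕ.+ k) (<⇒≤ 0<1)) (B^-nonneg n)

    pow-bounded : ∀ n →
      Bounded (re (z ^ᶜ n)) (B ^ n) × Bounded (im (z ^ᶜ n)) (B ^ n)
    pow-bounded zero =
      pos-bounded 0<1 , (<⇒≤ 0<1 , (-0#≈0# ≈≤ <⇒≤ 0<1))
      where open RingProperties ring using (-0#≈0#)
    pow-bounded (suc n) with pow-bounded n | proj₂ bound
    ... | r , i | rz , iz =
        weaken (+-bounded (*-bounded rz r) (neg-bounded (*-bounded iz i))) 2kBⁿ≤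
      , weaken (+-bounded (*-bounded rz i) (*-bounded iz r)) 2kBⁿ≤
      where
      2kBⁿ≤ : k · 1# * B ^ n + k · 1# * B ^ n ≤ B ^ suc n
      2kBⁿ≤ = ≤-reflexive
        (trans (sym (distribʳ _ _ _)) (*-congʳ (sym (×-homo-+ 1# k k))))

    b : ℕ → ℝ
    b n = invFactorial n * B ^ n

    b-nonneg : ∀ n → 0# ≤ b n
    b-nonneg n = *-nonneg (<⇒≤ (invFactorial-pos n)) (B^-nonneg n)

    term-bounded : ∀ n →
      Bounded (re (powOver! z n)) (b n) × Bounded (im (powOver! z n)) (b n)
    term-bounded n =
        *-bounded (pos-bounded (invFactorial-pos n)) (proj₁ (pow-bounded n))
      , *-bounded (pos-bounded (invFactorial-pos n)) (proj₂ (pow-bounded n))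

    b-half : ∀ n → K ℕ.≤ n → b (suc n) + b (suc n) ≤ b n
    b-half n K≤n = eq ≈≤ (*-monoʳ-≤ (b-nonneg n) ρ2B≤1 ≤≈ *-identityʳ _)
      where
      ρ = recip (suc n · 1#) (0<⇒#0 (0<n·1 n))
      ρ2B≤1 : ρ * (B + B) ≤ 1#
      ρ2B≤1 = *-monoʳ-≤ (<⇒≤ (recip-pos (0<n·1 n)))
          (sym (×-homo-+ 1# (k ℕ.+ k) (k ℕ.+ k)) ≈≤
           ·-monoˡ-≤ (<⇒≤ 0<1) (ℕ.≤-trans K≤n (ℕ.n≤1+n n)))
        ≤≈ trans (*-comm _ _) (recip-inverseʳ (suc n · 1#) (0<⇒#0 (0<n·1 n)))
      open NatSolver commutativeSemiring using (solve; _:=_; _:+_; _:*_)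
      eq : b (suc n) + b (suc n) ≈ b n * (ρ * (B + B))
      eq = solve 4 (λ i ρ B p →
        i :* ρ :* (B :* p) :+ i :* ρ :* (B :* p) := i :* p :* (ρ :* (B :+ B)))
        refl (invFactorial n) ρ B (B ^ n)

    re-cauchy : Cauchy (λ n → re (partialSum (powOver! z) n))
    re-cauchy = halving⇒cauchy _ _ b K (λ _ → refl) b-nonneg
      (λ n → proj₁ (term-bounded n)) b-half

    im-cauchy : Cauchy (λ n → im (partialSum (powOver! z) n))
    im-cauchy = halving⇒cauchy _ _ b K (λ _ → refl) b-nonneg
      (λ n → proj₂ (term-bounded n)) b-half

  -- The sum of the series Σ z ^ n / n!, taken componentwise.
  exp : ℂ → ℂ
  exp z = proj₁ (complete _ (ExpSeries.re-cauchy z))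
       +i proj₁ (complete _ (ExpSeries.im-cauchy z))

  -- Coefficients in order of increasing degree.
  Poly : Set c
  Poly = List ℂ

  eval : Poly → ℂ → ℂ
  eval []      x = 0ᶜ
  eval (a ∷ p) x = a +ᶜ x *ᶜ eval p x

  Disc : ℝ → Set (c ⊔ ℓ₃)
  Disc r = Σ ℂ λ t → ∣ t ∣< r

  centre : ∀ {r} → 0# < r → Disc r
  centre r>0 = 0ᶜ ,
    (trans (+-cong (zeroˡ 0#) (zeroˡ 0#)) (+-identityʳ 0#) ≈< *-pos r>0 r>0)

  -ᴰ_ : ∀ {r} → Disc r → Disc r
  -ᴰ (t , t<r) = -ᶜ t , (+-cong (-x*-x (re t)) (-x*-x (im t)) ≈< t<r)

  module _ {r : ℝ} where

    -- Complex differentiability at every point of the disc.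
    Holomorphic : (Disc r → ℂ) → Set (c ⊔ ℓ₃)
    Holomorphic f = ∀ (t : Disc r) → ∃ λ (f′ : ℂ) → ∀ {ε} → 0# < ε →
      ∃ λ δ → (0# < δ) × (∀ (s : Disc r) →
        let h = proj₁ s -ᶜ proj₁ t in
        ∣ h ∣< δ →
        -- |f s - f t - f′ h| ≤ ε |h|
        normSq (f s -ᶜ f t -ᶜ f′ *ᶜ h) ≤ ε * ε * normSq h)

    Odd : (Disc r → ℂ) → Set (c ⊔ ℓ₁ ⊔ ℓ₃)
    Odd g = ∀ (t : Disc r) → g (-ᴰ t) ≈ᶜ -ᶜ g t

    -- Σ Pₙ(x) tⁿ / n! = f(t) e^{xt} for all x and all |t| < r
    HasGeneratingFunction : (ℕ → Poly) → (Disc r → ℂ) → Set (c ⊔ ℓ₃)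
    HasGeneratingFunction P f = ∀ (x : ℂ) (t : Disc r) →
      HasSum (λ n → eval (P n) x *ᶜ powOver! (proj₁ t) n)
             (f t *ᶜ exp (x *ᶜ proj₁ t))

  -- The Euler polynomials: Σ Eₙ(x) tⁿ / n! = 2 e^{xt} / (e^t + 1) near t = 0.
  IsEuler : (ℕ → Poly) → Set (c ⊔ ℓ₂ ⊔ ℓ₃)
  IsEuler E = ∃ λ (ρ : ℝ) → (0# < ρ) ×
    (Σ ((t : Disc ρ) → (exp (proj₁ t) +ᶜ 1ᶜ) #0) λ eᵗ+1#0 →
      HasGeneratingFunction E λ t →
        2ᶜ *ᶜ inverse (exp (proj₁ t) +ᶜ 1ᶜ) (eᵗ+1#0 t))

{-# OPTIONS --safe #-}

-- Putting x = 0 and x = 1 in the symmetry of P gives f(t) e^t = f(-t), so the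
-- oddness of f - S, where S(t) = Σ_{k ≤ N} Eₖ(0) tᵏ / k!, becomes
-- f(t) (e^t + 1) = A(t) with A(t) = S(t) + S(-t).  The same symmetry gives
-- f(t) e^t e^{-t} = f(t), hence A(t) (e^t e^{-t} - 1) = 0; since A(0) = 2, this
-- yields e^t e^{-t} = 1 for small real t without multiplying exponential series.
-- Then g(t) = 2 / (e^t + 1) satisfies g(t) e^t = g(-t), and comparison of
-- coefficients gives Eₙ(1) = (-1)ⁿ Eₙ(0); together with Eₙ(0) + Eₙ(1) = 2 [n = 0]
-- this says A = 2 on the whole disc, so f = g there, and P = E by comparing
-- coefficients.  Coefficients are compared using small positive real t only.
module Submission where

open import Defs
open import Level using (_⊔_)
open import Algebra.Apartness.Bundles using (HeytingField)
open import Algebra.Bundles using (CommutativeRing)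
open import Algebra.Solver.Ring.AlmostCommutativeRing
  using (fromCommutativeRing; _-Raw-AlmostCommutative⟶_)
open import Data.Integer.Base as ℤ using (ℤ; +_; -[1+_]; _⊖_)
import Data.Integer.Properties as ℤ
open import Data.List.Base using ([]; _∷_)
open import Data.Maybe.Base using (Maybe; just; nothing)
open import Data.Nat.Base as ℕ using (ℕ; zero; suc; s≤s)
import Data.Nat.Properties as ℕ
open import Data.Product.Base using (Σ; ∃; _×_; _,_; proj₁; proj₂)
import Data.Sign.Base as Sign
open import Data.Sum.Base using (_⊎_; inj₁; inj₂)
open import Function.Base using (_∘_)
open import Relation.Nullary.Decidable.Core using (yes; no)
open import Relation.Nullary.Negation using (¬_)
import Algebra.Apartness.Properties.HeytingCommutativeRing as HeytingProperties
import Algebra.Properties.AbelianGroup as AbelianGroupProperties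
import Algebra.Properties.CommutativeSemiring.Exp as Exp
import Algebra.Properties.Ring as RingProperties
import Algebra.Properties.Semiring.Mult as Mult
import Algebra.Properties.Semiring.Mult.TCOptimised as MultTCOptimised
import Algebra.Solver.Ring
import Relation.Binary.PropositionalEquality.Core as ≡
import Relation.Binary.Reasoning.Setoid as SetoidReasoning

-- The two discs are unrelated: `f` lives on radius `r`, the Euler generating function on radius
-- `ρ`. What carries the formula to all of `Disc r` is that `A` is a polynomial: once its
-- coefficients are known, `A = 2` holds at every complex `t`, and `f(t) (e^t + 1) = 2` then also
-- supplies the apartness from zero that the quotient needs. The order is not assumed decidable, and
-- a function on a disc need not respect `≈ᶜ`. So divisions wait for a proof of apartness, minima
-- and maxima are avoided, and values of functions are compared through limits of series. Uniqueness
-- of coefficients rests on one estimate: convergence at a single point `t` bounds the terms there,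
-- hence for `x ≤ t / 2` everything after the head is at most `x` times a constant, uniformly in the
-- number of terms. Shrinking `x` isolates the head, and dividing by `x` gives access to the next
-- coefficient. The same uniform estimate, applied to a truncation, keeps `A` away from zero near 0.

-- A ring solver that can cancel needs coefficients whose equality is decidable.
module IntegerCoefficients {c ℓ} (R : CommutativeRing c ℓ) where

  open CommutativeRing R
  open RingProperties ring
  open AbelianGroupProperties +-abelianGroup using (⁻¹-∙-comm)
  open MultTCOptimised semiring using (×-homo-+; ×1-homo-*; 1+×) renaming (_×_ to _·_)
  open SetoidReasoning setoid

  -- The optimised multiple makes `fromℤ (+ 1)` compute to `1#` rather than to `1# + 0#`, so
  -- constants in solved equations match the goals by `refl`.
  fromℤ : ℤ → Carrier
  fromℤ (+ n)    = n · 1#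
  fromℤ -[1+ n ] = - (suc n · 1#)

  fromℤ-neg : ∀ i → fromℤ (ℤ.- i) ≈ - fromℤ i
  fromℤ-neg (+ zero)  = sym -0#≈0#
  fromℤ-neg (+ suc n) = refl
  fromℤ-neg -[1+ n ]  = sym (-‿involutive _)

  fromℤ-⊖ : ∀ m n → fromℤ (m ⊖ n) ≈ m · 1# - n · 1#
  fromℤ-⊖ m       zero    = sym (trans (+-congˡ -0#≈0#) (+-identityʳ _))
  fromℤ-⊖ zero    (suc n) = sym (+-identityˡ _)
  fromℤ-⊖ (suc m) (suc n) = begin
    fromℤ (suc m ⊖ suc n)                ≡⟨ ≡.cong fromℤ (ℤ.[1+m]⊖[1+n]≡m⊖n m n) ⟩
    fromℤ (m ⊖ n)                        ≈⟨ fromℤ-⊖ m n ⟩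
    m · 1# - n · 1#                      ≈⟨ +-identityˡ _ ⟨
    0# + (m · 1# - n · 1#)               ≈⟨ +-congʳ (-‿inverseʳ 1#) ⟨
    (1# - 1#) + (m · 1# - n · 1#)        ≈⟨ +-assoc _ _ _ ⟩
    1# + (- 1# + (m · 1# - n · 1#))      ≈⟨ +-congˡ (+-assoc _ _ _) ⟨
    1# + ((- 1# + m · 1#) - n · 1#)      ≈⟨ +-congˡ (+-congʳ (+-comm _ _)) ⟩
    1# + ((m · 1# - 1#) - n · 1#)        ≈⟨ +-congˡ (+-assoc _ _ _) ⟩
    1# + (m · 1# + (- 1# - n · 1#))      ≈⟨ +-assoc _ _ _ ⟨
    (1# + m · 1#) + (- 1# - n · 1#)      ≈⟨ +-congˡ (⁻¹-∙-comm _ _) ⟩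
    (1# + m · 1#) - (1# + n · 1#)        ≈⟨ +-cong (1+× m 1#) (-‿cong (1+× n 1#)) ⟨
    suc m · 1# - suc n · 1#              ∎

  fromℤ-+ : ∀ i j → fromℤ (i ℤ.+ j) ≈ fromℤ i + fromℤ j
  fromℤ-+ (+ m)    (+ n)    = ×-homo-+ 1# m n
  fromℤ-+ (+ m)    -[1+ n ] = fromℤ-⊖ m (suc n)
  fromℤ-+ -[1+ m ] (+ n)    = trans (fromℤ-⊖ n (suc m)) (+-comm _ _)
  fromℤ-+ -[1+ m ] -[1+ n ] = begin
    - (suc (suc (m ℕ.+ n)) · 1#)          ≡⟨ ≡.cong (λ k → - (suc k · 1#)) (ℕ.+-suc m n) ⟨
    - ((suc m ℕ.+ suc n) · 1#)            ≈⟨ -‿cong (×-homo-+ 1# (suc m) (suc n)) ⟩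
    - (suc m · 1# + suc n · 1#)           ≈⟨ ⁻¹-∙-comm _ _ ⟨
    - (suc m · 1#) - suc n · 1#           ∎

  fromℤ-◃- : ∀ n → fromℤ (Sign.- ℤ.◃ n) ≈ - (n · 1#)
  fromℤ-◃- zero    = sym -0#≈0#
  fromℤ-◃- (suc n) = refl

  fromℤ-* : ∀ i j → fromℤ (i ℤ.* j) ≈ fromℤ i * fromℤ j
  fromℤ-* (+ m) (+ n) = begin
    fromℤ (Sign.+ ℤ.◃ (m ℕ.* n))  ≡⟨ ≡.cong fromℤ (ℤ.+◃n≡+n (m ℕ.* n)) ⟩
    (m ℕ.* n) · 1#                ≈⟨ ×1-homo-* m n ⟩
    m · 1# * n · 1#               ∎
  fromℤ-* (+ m) -[1+ n ] = begin
    fromℤ (Sign.- ℤ.◃ (m ℕ.* suc n))  ≈⟨ fromℤ-◃- (m ℕ.* suc n) ⟩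
    - ((m ℕ.* suc n) · 1#)            ≈⟨ -‿cong (×1-homo-* m (suc n)) ⟩
    - (m · 1# * suc n · 1#)           ≈⟨ -‿distribʳ-* _ _ ⟩
    m · 1# * - (suc n · 1#)           ∎
  fromℤ-* -[1+ m ] (+ n) = begin
    fromℤ (Sign.- ℤ.◃ (suc m ℕ.* n))  ≈⟨ fromℤ-◃- (suc m ℕ.* n) ⟩
    - ((suc m ℕ.* n) · 1#)            ≈⟨ -‿cong (×1-homo-* (suc m) n) ⟩
    - (suc m · 1# * n · 1#)           ≈⟨ -‿distribˡ-* _ _ ⟩
    - (suc m · 1#) * n · 1#           ∎
  fromℤ-* -[1+ m ] -[1+ n ] = begin
    (suc m ℕ.* suc n) · 1#             ≈⟨ ×1-homo-* (suc m) (suc n) ⟩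
    suc m · 1# * suc n · 1#            ≈⟨ -‿involutive _ ⟨
    - - (suc m · 1# * suc n · 1#)      ≈⟨ -‿cong (-‿distribʳ-* _ _) ⟩
    - (suc m · 1# * - (suc n · 1#))    ≈⟨ -‿distribˡ-* _ _ ⟩
    - (suc m · 1#) * - (suc n · 1#)    ∎

  homomorphism : CommutativeRing.rawRing ℤ.+-*-commutativeRing
                 -Raw-AlmostCommutative⟶ fromCommutativeRing R
  homomorphism = record
    { ⟦_⟧    = fromℤ
    ; +-homo = fromℤ-+
    ; *-homo = fromℤ-*
    ; -‿homo = fromℤ-neg
    ; 0-homo = refl
    ; 1-homo = refl
    }

  weak-dec : ∀ i j → Maybe (fromℤ i ≈ fromℤ j)
  weak-dec i j with i ℤ.≟ j
  ... | yes i≡j = just (reflexive (≡.cong fromℤ i≡j))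
  ... | no  _   = nothing

  open Algebra.Solver.Ring _ _ homomorphism weak-dec public

-- The real field: order, limits and power series.

module RealAnalysis {c ℓ₁ ℓ₂ ℓ₃} (R : RealField c ℓ₁ ℓ₂ ℓ₃) where

  open RealField R
  open RealProperties R
  open IntegerCoefficients commutativeRing
  open CommutativeRing commutativeRing using (ring; semiring)
  open RingProperties ring using (-0#≈0#)
  open Mult semiring using (×-assoc-*; ×-congʳ)

  ≤-antisym : ∀ {x y} → x ≤ y → y ≤ x → x ≈ y
  ≤-antisym {x} {y} p q = proj₁ (tight x y) λ x#y → absurd (#⇒<⊎> x#y)
    where
    absurd : ¬ ((x < y) ⊎ (y < x))
    absurd (inj₁ x<y) = q x<y
    absurd (inj₂ y<x) = p y<x

  *-monoˡ-< : ∀ {x y z} → 0# < z → x < y → x * z < y * z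
  *-monoˡ-< {x} {y} {z} p q = 0<-⇒< (*-pos (<⇒0<- q) p <≈
    solve 3 (λ x y z → (y :- x) :* z := y :* z :- x :* z) refl x y z)

  *-cancelˡ-< : ∀ {x y z} → 0# < z → z * x < z * y → x < y
  *-cancelˡ-< {x} {y} {z} p q = 0<-⇒< (*-cancel-pos p (<⇒0<- q <≈
    solve 3 (λ x y z → z :* y :- z :* x := (y :- x) :* z) refl x y z))

  half : ∀ {ε} → 0# < ε → ∃ λ δ → (0# < δ) × (δ + δ ≈ ε)
  half {ε} p = ε * h , *-pos p (recip-pos 0<2) , trans
    (solve 2 (λ ε h → ε :* h :+ ε :* h := ε :* ((con (+ 1) :+ con (+ 1)) :* h))
       refl ε h)
    (trans (*-congˡ (recip-inverseʳ _ (0<⇒#0 0<2))) (*-identityʳ ε))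
    where
    0<2 : 0# < 1# + 1#
    0<2 = <-trans 0<1 (sym (+-identityˡ 1#) ≈< +-monoˡ-< 1# 0<1)
    h = recip (1# + 1#) (0<⇒#0 0<2)

  half< : ∀ {δ ε} → 0# < δ → δ + δ ≈ ε → δ < ε
  half< p e = sym (+-identityˡ _) ≈< +-monoˡ-< _ p <≈ e

  -- No square root or absolute value is taken. Cotransitivity gives `x < 0`, where the claim is
  -- clear, or `- ε < x`, where the positive factor `ε + x` cancels from `ε² - x² = (ε - x)(ε + x)`.
  square-cancel-< : ∀ {x ε} → 0# < ε → x * x < ε * ε → x < ε
  square-cancel-< {x} {ε} 0<ε p with <-cotrans (-ε<0) x
    where
    -ε<0 : - ε < 0#
    -ε<0 = 0<-⇒< (0<ε <≈ solve 1 (λ ε → ε := con (+ 0) :- :- ε) refl ε)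
  ... | inj₂ x<0 = <-trans x<0 0<ε
  ... | inj₁ -ε<x = 0<-⇒< (*-cancel-pos (<⇒0<- -ε<x) (<⇒0<- p <≈
    solve 2 (λ x ε → ε :* ε :- x :* x := (ε :- x) :* (x :- :- ε)) refl x ε))

  -- The sign of `x` cannot be decided beforehand. The assumption `x² < 0` makes `x` invertible,
  -- hence apart from zero, and then either sign gives `x² > 0`.
  square-nonneg : ∀ x → 0# ≤ x * x
  square-nonneg x x²<0 = <-irrefl refl (<-trans (x*x>0 (#⇒<⊎> x#0)) x²<0)
    where
    open HeytingProperties (HeytingField.heytingCommutativeRing heytingField)
      using (invertibleˡ⇒#; x-0≈x)
    0<-x² = neg-pos x²<0
    i = recip (- (x * x)) (0<⇒#0 0<-x²)
    x#0 : x # 0#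
    x#0 = invertibleˡ⇒# (- x * i , trans (*-congˡ (x-0≈x x)) (trans
      (solve 2 (λ x i → :- x :* i :* x := :- (x :* x) :* i) refl x i)
      (recip-inverseʳ _ (0<⇒#0 0<-x²))))
    x*x>0 : (x < 0#) ⊎ (0# < x) → 0# < x * x
    x*x>0 (inj₁ p) = *-pos (neg-pos p) (neg-pos p) <≈ -x*-x x
    x*x>0 (inj₂ p) = *-pos p p

  bounded-cong : ∀ {x y b} → x ≈ y → Bounded x b → Bounded y b
  bounded-cong e (p , q) = (sym e ≈≤ p) , (sym (-‿cong e) ≈≤ q)

  nonneg-bounded : ∀ {x} → 0# ≤ x → Bounded x x
  nonneg-bounded {x} p = ≤-refl , ≤-trans
    (0≤-⇒≤ (p ≤≈ solve 1 (λ x → x := con (+ 0) :- :- x) refl x)) p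

  -- The bound is doubled to fit a triangle inequality with two errors of size `ε`.
  bounded-by-all⇒0 : ∀ {x} → (∀ {ε} → 0# < ε → Bounded x (ε + ε)) → x ≈ 0#
  bounded-by-all⇒0 {x} b = ≤-antisym (below x (λ p → proj₁ (b p)))
    (0≤-⇒≤ (≤⇒0≤- (below (- x) (λ p → proj₂ (b p))) ≤≈
      solve 1 (λ x → con (+ 0) :- :- x := x :- con (+ 0)) refl x))
    where
    below : ∀ y → (∀ {ε} → 0# < ε → y ≤ ε + ε) → y ≤ 0#
    below y h 0<y =
      -- Two halvings give `ε + ε = y / 2 < y`, against `y ≤ ε + ε`.
      let δ , 0<δ , 2δ≈y = half 0<y
          ε , 0<ε , 2ε≈δ = half 0<δ
      in h 0<ε (2ε≈δ ≈< half< 0<δ 2δ≈y)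

  -- Limits

  converges-≤ : ∀ {s s′ l l′} → ConvergesTo s l → ConvergesTo s′ l′ →
    (∀ n → s n ≤ s′ n) → l ≤ l′
  converges-≤ {s} {s′} {l} {l′} s→l s′→l′ s≤s′ l′<l =
    let δ , 0<δ , 2δ≈ = half (<⇒0<- l′<l)
        N , close = s→l 0<δ
        N′ , close′ = s′→l′ 0<δ
        n = N ℕ.+ N′
        l<sn+δ = proj₂ (close n (ℕ.m≤m+n N N′))
        s′n<l′+δ = proj₁ (close′ n (ℕ.m≤n+m N′ N))
    in <-irrefl refl (<-trans l<sn+δ
         (≤-<-trans (+-monoˡ-≤ δ (s≤s′ n)) (+-monoˡ-< δ s′n<l′+δ)
           <≈ trans (+-assoc l′ δ δ) (trans (+-congˡ 2δ≈)
             (solve 2 (λ l l′ → l′ :+ (l :- l′) := l) refl l l′))))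

  converges-unique : ∀ {s s′ l l′} → (∀ n → s n ≈ s′ n) →
    ConvergesTo s l → ConvergesTo s′ l′ → l ≈ l′
  converges-unique e s→l s′→l′ = ≤-antisym
    (converges-≤ s→l s′→l′ λ n → ≤-reflexive (e n))
    (converges-≤ s′→l′ s→l λ n → ≤-reflexive (sym (e n)))

  converges-cong : ∀ {s s′ l l′} → (∀ n → s n ≈ s′ n) → l ≈ l′ →
    ConvergesTo s l → ConvergesTo s′ l′
  converges-cong e e′ s→l 0<ε =
    let N , close = s→l 0<ε in N , λ n N≤n → let p , q = close n N≤n in
      (sym (e n) ≈< p <≈ +-congʳ e′) , (sym e′ ≈< q <≈ +-congʳ (e n))

  -- Index 0 is exempt because partial sums start from the empty sum, while a series whose later
  -- terms vanish is constant from index 1 on.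
  converges-eventually-const : ∀ {s l} → (∀ n → s (suc n) ≈ l) →
    ConvergesTo s l
  converges-eventually-const e {ε} 0<ε = 1 , λ where
      (suc n) _ → (e n ≈< below) , (sym (e n) ≈< below)
    where
    below : ∀ {x} → x < x + ε
    below = sym (+-identityʳ _) ≈< +-monoʳ-< _ 0<ε

  converges-+ : ∀ {s s′ l l′} → ConvergesTo s l → ConvergesTo s′ l′ →
    ConvergesTo (λ n → s n + s′ n) (l + l′)
  converges-+ {s} {s′} {l} {l′} s→l s′→l′ {ε} 0<ε =
    let δ , 0<δ , 2δ≈ε = half 0<ε
        N , close = s→l 0<δ
        N′ , close′ = s′→l′ 0<δ
        add : ∀ {x y x′ y′} → x < y + δ → x′ < y′ + δ → x + x′ < (y + y′) + ε
        add p q = <-trans (+-monoˡ-< _ p) (+-monoʳ-< _ q) <≈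
          trans (solve 3 (λ y y′ δ →
            y :+ δ :+ (y′ :+ δ) := (y :+ y′) :+ (δ :+ δ)) refl _ _ δ)
            (+-congˡ 2δ≈ε)
    in N ℕ.+ N′ , λ n le →
      let p , q = close n (ℕ.≤-trans (ℕ.m≤m+n N N′) le)
          p′ , q′ = close′ n (ℕ.≤-trans (ℕ.m≤n+m N′ N) le)
      in add p p′ , add q q′

  converges-neg : ∀ {s l} → ConvergesTo s l → ConvergesTo (λ n → - s n) (- l)
  converges-neg s→l {ε} 0<ε =
    let N , close = s→l 0<ε
        flip : ∀ {x y} → x < y + ε → - y < - x + ε
        flip {x} {y} p = 0<-⇒< (<⇒0<- p <≈
          solve 3 (λ x y ε → y :+ ε :- x := :- x :+ ε :- :- y) refl x y ε)
    in N , λ n le → let p , q = close n le in flip q , flip p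

  natural-bound : ∀ x → ∃ λ k → Bounded x (k · 1#)
  natural-bound x =
    let k₁ , p₁ = archimedean x 0<1
        k₂ , p₂ = archimedean (- x) 0<1
    in k₁ ℕ.+ k₂ ,
       ≤-trans (<⇒≤ p₁) (·-monoˡ-≤ (<⇒≤ 0<1) (ℕ.m≤m+n k₁ k₂)) ,
       ≤-trans (<⇒≤ p₂) (·-monoˡ-≤ (<⇒≤ 0<1) (ℕ.m≤n+m k₂ k₁))

  -- Bounds are natural multiples of `1#`, so adding them replaces taking a maximum.
  initial-bound : ∀ (a : ℕ → Carrier) N →
    ∃ λ k → ∀ n → n ℕ.< N → Bounded (a n) (k · 1#)
  initial-bound a zero    = 0 , λ _ ()
  initial-bound a (suc N) =
    let k , b = natural-bound (a 0)
        k′ , b′ = initial-bound (a ∘ suc) N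
    in k ℕ.+ k′ , λ where
      zero    _        → weaken b (·-monoˡ-≤ (<⇒≤ 0<1) (ℕ.m≤m+n k k′))
      (suc n) (s≤s lt) → weaken (b′ n lt) (·-monoˡ-≤ (<⇒≤ 0<1) (ℕ.m≤n+m k′ k))

  -- Applied to partial sums, this bounds the terms of a convergent series. From `N` on, consecutive
  -- values lie within 1 of the limit and differ by at most 2; the finitely many earlier increments
  -- are bounded one by one.
  increments-bounded : ∀ {s l} → ConvergesTo s l →
    ∃ λ k → ∀ n → Bounded (s (suc n) - s n) (k · 1#)
  increments-bounded {s} {l} s→l = k ℕ.+ 2 , bound
    where
    N = proj₁ (s→l 0<1)
    close = proj₂ (s→l 0<1)
    k = proj₁ (initial-bound (λ n → s (suc n) - s n) N)
    small : ∀ {x y} → x < l + 1# → l < y + 1# → x - y ≤ 2 · 1#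
    small {x} {y} p q = <⇒≤ (0<-⇒< (<⇒0<- (<-trans p (+-monoˡ-< 1# q)) <≈
      solve 2 (λ x y → y :+ con (+ 1) :+ con (+ 1) :- x
        := con (+ 1) :+ (con (+ 1) :+ con (+ 0)) :- (x :- y)) refl x y))
    bound : ∀ n → Bounded (s (suc n) - s n) ((k ℕ.+ 2) · 1#)
    bound n with n ℕ.<? N
    ... | yes n<N = weaken (proj₂ (initial-bound _ N) n n<N)
      (·-monoˡ-≤ (<⇒≤ 0<1) (ℕ.m≤m+n k 2))
    ... | no n≮N = weaken
        ( small (proj₁ next) (proj₂ here)
        , (solve 2 (λ x y → :- (x :- y) := y :- x) refl _ _
            ≈≤ small (proj₁ here) (proj₂ next)))
        (·-monoˡ-≤ (<⇒≤ 0<1) (ℕ.m≤n+m 2 k))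
      where
      here = close n (ℕ.≮⇒≥ n≮N)
      next = close (suc n) (ℕ.≤-trans (ℕ.≮⇒≥ n≮N) (ℕ.n≤1+n n))

  -- Power series

  powerSum : (ℕ → Carrier) → Carrier → ℕ → Carrier
  powerSum α x zero    = 0#
  powerSum α x (suc n) = powerSum α x n + α n * x ^ n

  powerSum-shift : ∀ α x n →
    powerSum α x (suc n) ≈ α 0 + x * powerSum (α ∘ suc) x n
  powerSum-shift α x zero    =
    solve 2 (λ a x → con (+ 0) :+ a :* con (+ 1) := a :+ x :* con (+ 0))
      refl (α 0) x
  powerSum-shift α x (suc n) = trans (+-congʳ (powerSum-shift α x n))
    (solve 5 (λ a x p b y → a :+ x :* p :+ b :* (x :* y)
      := a :+ x :* (p :+ b :* y)) refl
      (α 0) x (powerSum (α ∘ suc) x n) (α (suc n)) (x ^ n))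

  powerSum-minus : ∀ α β x n →
    powerSum (λ k → α k - β k) x n ≈ powerSum α x n - powerSum β x n
  powerSum-minus α β x zero    = sym (-‿inverseʳ 0#)
  powerSum-minus α β x (suc n) = trans (+-congʳ (powerSum-minus α β x n))
    (solve 5 (λ p q a b y → p :- q :+ (a :- b) :* y
      := p :+ a :* y :- (q :+ b :* y)) refl _ _ (α n) (β n) (x ^ n))

  -- Comparison with a geometric series of ratio x / t ≤ 1/2, in Horner form.
  powerSum-bounded : ∀ {x t u} → 0# ≤ x → x + x ≤ t → 0# < u → t * u ≈ 1# →
    ∀ n α {M} → 0# ≤ M → (∀ k → Bounded (α k * t ^ k) M) →
    Bounded (powerSum α x n) (M + M)
  powerSum-bounded 0≤x 2x≤t 0<u tu≈1 zero α 0≤M b =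
    0≤2M , (-0#≈0# ≈≤ 0≤2M)
    where 0≤2M = sym (+-identityˡ 0#) ≈≤ +-mono-≤ 0≤M 0≤M
  powerSum-bounded {x} {t} {u} 0≤x 2x≤t 0<u tu≈1 (suc n) α {M} 0≤M b =
    bounded-cong (sym (powerSum-shift α x n))
      (+-bounded (bounded-cong (*-identityʳ (α 0)) (b 0))
        (weaken (*-bounded (nonneg-bounded 0≤x) rest) xMu≤M))
    where
    -- The shifted terms are the old ones times `u = 1 / t`, so `M` becomes `M * u`; the factor
    -- `x ≤ t / 2` turns `2 M u` back into at most `M`.
    rest = powerSum-bounded 0≤x 2x≤t 0<u tu≈1 n (α ∘ suc)
      (*-nonneg 0≤M (<⇒≤ 0<u)) λ k → bounded-cong
        (trans (solve 4 (λ a t y u → a :* (t :* y) :* u := a :* y :* (t :* u))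
                  refl (α (suc k)) t (t ^ k) u)
               (trans (*-congˡ tu≈1) (*-identityʳ _)))
        (*-bounded (b (suc k)) (pos-bounded 0<u))
    xMu≤M : x * (M * u + M * u) ≤ M
    xMu≤M = solve 3 (λ x M u → x :* (M :* u :+ M :* u) := (x :+ x) :* (M :* u))
              refl x M u
      ≈≤ (*-monoˡ-≤ (*-nonneg 0≤M (<⇒≤ 0<u)) 2x≤t
      ≤≈ trans (solve 3 (λ t M u → t :* (M :* u) := M :* (t :* u)) refl t M u)
           (trans (*-congˡ tu≈1) (*-identityʳ M)))

  -- One-sided and without 0 itself, so that division by `x` is always possible.
  record Near0 {p} (Q : Carrier → Set p) : Set (c ⊔ ℓ₃ ⊔ p) where
    constructor near
    field
      radius   : Carrier
      radius>0 : 0# < radius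
      holds    : ∀ x → 0# < x → x < radius → Q x

  near-map : ∀ {p q} {P : Carrier → Set p} {Q : Carrier → Set q} →
    Near0 P → (∀ x → 0# < x → P x → Q x) → Near0 Q
  near-map (near δ 0<δ h) f = near δ 0<δ λ x p q → f x p (h x p q)

  -- In place of a minimum of the radii, cotransitivity places `δ′` relative to `δ / 2 < δ`: either
  -- `δ / 2 < δ′`, and `δ / 2` serves, or `δ′ < δ`, and `δ′` does.
  near-∩ : ∀ {p q} {P : Carrier → Set p} {Q : Carrier → Set q} →
    Near0 P → Near0 Q → Near0 (λ x → P x × Q x)
  near-∩ {P = P} {Q} (near δ 0<δ h) (near δ′ 0<δ′ h′) =
    let η , 0<η , 2η≈δ = half 0<δ
        η<δ = half< 0<η 2η≈δ
    in smaller 0<η η<δ (<-cotrans η<δ δ′)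
    where
    smaller : ∀ {η} → 0# < η → η < δ → (η < δ′) ⊎ (δ′ < δ) →
      Near0 (λ x → P x × Q x)
    smaller {η} 0<η η<δ (inj₁ η<δ′) = near η 0<η λ x p q →
      h x p (<-trans q η<δ) , h′ x p (<-trans q η<δ′)
    smaller 0<η η<δ (inj₂ δ′<δ) = near δ′ 0<δ′ λ x p q →
      h x p (<-trans q δ′<δ) , h′ x p q

  near-below : ∀ {ε} → 0# < ε → Near0 (_< ε)
  near-below {ε} 0<ε = near ε 0<ε λ _ _ p → p

  near-witness : ∀ {p} {P : Carrier → Set p} → Near0 P →
    ∃ λ x → (0# < x) × P x
  near-witness (near δ 0<δ h) =
    let x , 0<x , 2x≈δ = half 0<δ in x , 0<x , h x 0<x (half< 0<x 2x≈δ)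

  near-*≤ : ∀ C {ε} → 0# < ε → Near0 (λ x → x * C ≤ ε)
  near-*≤ C {ε} 0<ε =
    near (recip m (0<⇒#0 0<m)) (recip-pos 0<m)
    λ x 0<x x<ρ → bound 0<x x<ρ (recip-inverseʳ m (0<⇒#0 0<m))
    where
    n = proj₁ (archimedean C 0<ε)
    -- The successor makes `m` positive even if `n` is 0, so that `1 / m` can be the radius.
    m = suc n · 1#
    0<m = 0<n·1 n
    C≤mε : C ≤ m * ε
    C≤mε = ≤-trans (<⇒≤ (proj₂ (archimedean C 0<ε)))
      (·-monoˡ-≤ (<⇒≤ 0<ε) (ℕ.n≤1+n n))
      ≤≈ trans (×-congʳ (suc n) (sym (*-identityˡ ε)))
               (sym (×-assoc-* (suc n) 1# ε))
    bound : ∀ {x ρ} → 0# < x → x < ρ → m * ρ ≈ 1# → x * C ≤ ε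
    bound {x} {ρ} 0<x x<ρ mρ≈1 = ≤-trans (*-monoʳ-≤ (<⇒≤ 0<x) C≤mε)
      (*-monoˡ-≤ (<⇒≤ (*-pos 0<m 0<ε)) (<⇒≤ x<ρ) ≤≈ trans
        (solve 3 (λ r m e → r :* (m :* e) := m :* r :* e) refl ρ m ε)
        (trans (*-congʳ mρ≈1) (*-identityˡ ε)))

  -- The sum without its head is `x` times the shifted sum. Terms bounded by `k` at one point `t`
  -- bound the shifted coefficients, so for `x ≤ t / 2` the rest is at most `2 x k / t` for every
  -- `n`; the second smallness condition puts this below `ε`.
  powerSum-near-head : ∀ α →
    Near0 (λ x → ∃ λ l → ConvergesTo (powerSum α x) l) → ∀ {ε} → 0# < ε →
    Near0 (λ x → ∀ n → Bounded (powerSum α x (suc n) - α 0) ε)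
  powerSum-near-head α conv {ε} 0<ε =
    let t , 0<t , l , α-conv = near-witness conv
        k , b = increments-bounded α-conv
    in near-map
      (near-∩ (near-*≤ (1# + 1#) 0<t)
              (near-*≤ (k · 1# * recip t (0<⇒#0 0<t) +
                        k · 1# * recip t (0<⇒#0 0<t)) 0<ε))
      λ x 0<x (x2≤t , xC≤ε) → bound t k x 0<x (recip-pos 0<t)
        (recip-inverseʳ t (0<⇒#0 0<t)) b x2≤t xC≤ε
    where
    bound : ∀ t k x {u} → 0# < x → 0# < u → t * u ≈ 1# →
      (∀ n → Bounded (powerSum α t (suc n) - powerSum α t n) (k · 1#)) →
      x * (1# + 1#) ≤ t → x * (k · 1# * u + k · 1# * u) ≤ ε →
      ∀ n → Bounded (powerSum α x (suc n) - α 0) ε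
    bound t k x {u} 0<x 0<u tu≈1 b x2≤t xC≤ε n = bounded-cong
      (trans (solve 2 (λ a y → y := a :+ y :- a) refl (α 0) _)
        (+-congʳ (sym (powerSum-shift α x n))))
      (weaken (*-bounded (pos-bounded 0<x)
        (powerSum-bounded (<⇒≤ 0<x)
          (solve 1 (λ x → x :+ x := x :* (con (+ 1) :+ con (+ 1))) refl x
            ≈≤ x2≤t)
          0<u tu≈1 n (α ∘ suc)
          (*-nonneg (·-nonneg k (<⇒≤ 0<1)) (<⇒≤ 0<u)) term-bounded)) xC≤ε)
      where
      term-bounded : ∀ j → Bounded (α (suc j) * t ^ j) (k · 1# * u)
      term-bounded j = bounded-cong
        (trans (solve 5 (λ p a t y u → (p :+ a :* (t :* y) :- p) :* u
                  := a :* y :* (t :* u)) refl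
                  (powerSum α t (suc j)) (α (suc j)) t (t ^ j) u)
               (trans (*-congˡ tu≈1) (*-identityʳ _)))
        (*-bounded (b (suc j)) (pos-bounded 0<u))

  Vanishes : (ℕ → Carrier) → Set (c ⊔ ℓ₃)
  Vanishes α = Near0 λ x → ConvergesTo (powerSum α x) 0#

  -- At one small `x`, a long partial sum is within `ε` of both 0 and `α 0`.
  vanishes⇒head≈0 : ∀ {α} → Vanishes α → α 0 ≈ 0#
  vanishes⇒head≈0 {α} v = bounded-by-all⇒0 λ {ε} 0<ε →
    let x , 0<x , v-x , tail = near-witness
          (near-∩ v (powerSum-near-head α (near-map v λ _ _ → 0# ,_) 0<ε))
        N , close = v-x 0<ε
        -- `suc N` terms, as the estimate of `tail` concerns partial sums that contain the head.
        p , q = close (suc N) (ℕ.n≤1+n N)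
        small : Bounded (powerSum α x (suc N)) ε
        small = <⇒≤ (p <≈ +-identityˡ ε)
              , <⇒≤ (0<-⇒< (<⇒0<- q <≈
                  solve 2 (λ y ε → y :+ ε :- con (+ 0) := ε :- :- y) refl _ ε))
    in bounded-cong (solve 2 (λ y a → y :+ :- (y :- a) := a) refl _ (α 0))
         (+-bounded small (neg-bounded (tail N)))

  -- The head vanishes, so the partial sums are `x` times the shifted ones; tolerance `x * ε` before
  -- dividing by `x > 0` becomes tolerance `ε` after it.
  vanishes-shift : ∀ {α} → Vanishes α → Vanishes (α ∘ suc)
  vanishes-shift {α} v@(near δ 0<δ conv) =
    near δ 0<δ λ x 0<x x<δ → divide 0<x (conv x 0<x x<δ)
    where
    divide : ∀ {x} → 0# < x → ConvergesTo (powerSum α x) 0# →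
      ConvergesTo (powerSum (α ∘ suc) x) 0#
    divide {x} 0<x sums {ε} 0<ε =
      let N , close = sums (*-pos 0<x 0<ε)
          shift : ∀ n → powerSum α x (suc n) ≈ x * powerSum (α ∘ suc) x n
          shift n = trans (powerSum-shift α x n)
            (trans (+-congʳ (vanishes⇒head≈0 v)) (+-identityˡ _))
      in N , λ n N≤n →
        let p , q = close (suc n) (ℕ.≤-trans N≤n (ℕ.n≤1+n n)) in
          *-cancelˡ-< 0<x (sym (shift n) ≈< p <≈
            solve 2 (λ x ε → con (+ 0) :+ x :* ε := x :* (con (+ 0) :+ ε))
              refl x ε)
        , *-cancelˡ-< 0<x (zeroʳ x ≈< q <≈
            trans (+-congʳ (shift n)) (sym (distribˡ x _ ε)))

  vanishes⇒≈0 : ∀ n {α} → Vanishes α → α n ≈ 0#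
  vanishes⇒≈0 zero    v = vanishes⇒head≈0 v
  vanishes⇒≈0 (suc n) v = vanishes⇒≈0 n (vanishes-shift v)

  powerSeries-unique : ∀ {α β} →
    Near0 (λ x → ∃ λ l → ConvergesTo (powerSum α x) l
                        × ConvergesTo (powerSum β x) l) →
    ∀ n → α n ≈ β n
  powerSeries-unique {α} {β} h n =
    trans (solve 2 (λ a b → a := a :- b :+ b) refl (α n) (β n))
      (trans (+-congʳ (vanishes⇒≈0 n α-β-vanishes)) (+-identityˡ (β n)))
    where
    α-β-vanishes : Vanishes (λ k → α k - β k)
    open Near0 h
    α-β-vanishes = near radius radius>0 λ x 0<x x<δ →
      let l , p , q = holds x 0<x x<δ in
      converges-cong (λ k → sym (powerSum-minus α β x k)) (-‿inverseʳ l)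
        (converges-+ p (converges-neg q))

module ComplexNumbers {c ℓ₁ ℓ₂ ℓ₃} (R : RealField c ℓ₁ ℓ₂ ℓ₃) where

  -- exp is kept in the form Complex.exp R: an instantiated copy would be
  -- unfolded during conversion checking, down to its proofs of convergence.
  open Complex using (exp)
  open Complex R hiding (exp)

  -- The ring of complex numbers.

  module ComplexRing where

    open RealField R hiding (Carrier; 0#; _<_)
    open RealProperties R
    open IntegerCoefficients commutativeRing

    ℂ-ring : CommutativeRing c ℓ₁
    ℂ-ring = record
      { Carrier = ℂ
      ; _≈_ = _≈ᶜ_
      ; _+_ = _+ᶜ_
      ; _*_ = _*ᶜ_
      ; -_ = -ᶜ_
      ; 0# = 0ᶜ
      ; 1# = 1ᶜ
      ; isCommutativeRing = record
        { isRing = record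
          { +-isAbelianGroup = record
            { isGroup = record
              { isMonoid = record
                { isSemigroup = record
                  { isMagma = record
                    { isEquivalence = record
                      { refl = refl , refl
                      ; sym = λ (p , q) → sym p , sym q
                      ; trans = λ (p , q) (p′ , q′) → trans p p′ , trans q q′
                      }
                    ; ∙-cong = λ (p , q) (p′ , q′) → +-cong p p′ , +-cong q q′
                    }
                  ; assoc = λ _ _ _ → +-assoc _ _ _ , +-assoc _ _ _
                  }
                ; identity = (λ _ → +-identityˡ _ , +-identityˡ _)
                           , (λ _ → +-identityʳ _ , +-identityʳ _)
                }
              ; inverse = (λ _ → -‿inverseˡ _ , -‿inverseˡ _)
                        , (λ _ → -‿inverseʳ _ , -‿inverseʳ _)
              ; ⁻¹-cong = λ (p , q) → -‿cong p , -‿cong q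
              }
            ; comm = λ _ _ → +-comm _ _ , +-comm _ _
            }
          ; *-cong = λ (p , q) (p′ , q′) →
                +-cong (*-cong p p′) (-‿cong (*-cong q q′))
              , +-cong (*-cong p q′) (*-cong q p′)
          ; *-assoc = λ (x +i x′) (y +i y′) (z +i z′) →
                solve 6 (λ x x′ y y′ z z′ →
                  (x :* y :- x′ :* y′) :* z :- (x :* y′ :+ x′ :* y) :* z′
                  := x :* (y :* z :- y′ :* z′) :- x′ :* (y :* z′ :+ y′ :* z))
                  refl x x′ y y′ z z′
              , solve 6 (λ x x′ y y′ z z′ →
                  (x :* y :- x′ :* y′) :* z′ :+ (x :* y′ :+ x′ :* y) :* z
                  := x :* (y :* z′ :+ y′ :* z) :+ x′ :* (y :* z :- y′ :* z′))
                  refl x x′ y y′ z z′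
          ; *-identity =
                (λ (x +i y) → solve 2 (λ x y →
                    con (+ 1) :* x :- con (+ 0) :* y := x) refl x y
                  , solve 2 (λ x y →
                    con (+ 1) :* y :+ con (+ 0) :* x := y) refl x y)
              , (λ (x +i y) → solve 2 (λ x y →
                    x :* con (+ 1) :- y :* con (+ 0) := x) refl x y
                  , solve 2 (λ x y →
                    x :* con (+ 0) :+ y :* con (+ 1) := y) refl x y)
          ; distrib =
                (λ (x +i x′) (y +i y′) (z +i z′) →
                  solve 6 (λ x x′ y y′ z z′ →
                    x :* (y :+ z) :- x′ :* (y′ :+ z′)
                    := (x :* y :- x′ :* y′) :+ (x :* z :- x′ :* z′))
                    refl x x′ y y′ z z′
                , solve 6 (λ x x′ y y′ z z′ →
                    x :* (y′ :+ z′) :+ x′ :* (y :+ z)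
                    := (x :* y′ :+ x′ :* y) :+ (x :* z′ :+ x′ :* z))
                    refl x x′ y y′ z z′)
              , (λ (x +i x′) (y +i y′) (z +i z′) →
                  solve 6 (λ x x′ y y′ z z′ →
                    (y :+ z) :* x :- (y′ :+ z′) :* x′
                    := (y :* x :- y′ :* x′) :+ (z :* x :- z′ :* x′))
                    refl x x′ y y′ z z′
                , solve 6 (λ x x′ y y′ z z′ →
                    (y :+ z) :* x′ :+ (y′ :+ z′) :* x
                    := (y :* x′ :+ y′ :* x) :+ (z :* x′ :+ z′ :* x))
                    refl x x′ y y′ z z′)
          }
        ; *-comm = λ (x +i x′) (y +i y′) →
              solve 4 (λ x x′ y y′ →
                x :* y :- x′ :* y′ := y :* x :- y′ :* x′) refl x x′ y y′
            , solve 4 (λ x x′ y y′ →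
                x :* y′ :+ x′ :* y := y :* x′ :+ y′ :* x) refl x x′ y y′
        }
      }

  -- Norm, limits and exponential of complex numbers.

  module ComplexAnalysis where

    open RealField R hiding (Carrier; 0#; _<_)
    open RealProperties R
    open RealAnalysis R
    open ComplexRing
    open IntegerCoefficients commutativeRing
    open HeytingProperties (HeytingField.heytingCommutativeRing heytingField)
      using (invertibleˡ⇒#; x-0≈x)
    private
      module ℂ-Ring = CommutativeRing ℂ-ring
      module ℂ-Solver = IntegerCoefficients ℂ-ring
      module ℂ-Exp = Exp ℂ-Ring.commutativeSemiring

    -- This is Brahmagupta's two-square identity.
    normSq-* : ∀ z w → normSq (z *ᶜ w) ≈ normSq z * normSq w
    normSq-* (x +i x′) (y +i y′) = solve 4 (λ x x′ y y′ →
      (x :* y :- x′ :* y′) :* (x :* y :- x′ :* y′) :+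
      (x :* y′ :+ x′ :* y) :* (x :* y′ :+ x′ :* y)
      := (x :* x :+ x′ :* x′) :* (y :* y :+ y′ :* y′)) refl x x′ y y′

    normSq-cong : ∀ {z w} → z ≈ᶜ w → normSq z ≈ normSq w
    normSq-cong (p , q) = +-cong (*-cong p p) (*-cong q q)

    *-inverseʳ : ∀ z (z#0 : z #0) → z *ᶜ inverse z z#0 ≈ᶜ 1ᶜ
    *-inverseʳ z@(x +i y) z#0 =
        trans (solve 3 (λ x y n → x :* (n :* x) :- y :* (n :* :- y)
                 := (x :* x :+ y :* y) :* n) refl x y (recip (normSq z) z#0))
          (recip-inverseʳ (normSq z) z#0)
      , solve 3 (λ x y n → x :* (n :* :- y) :+ y :* (n :* x) := con (+ 0))
          refl x y (recip (normSq z) z#0)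

    *≈1⇒#0 : ∀ z w → z *ᶜ w ≈ᶜ 1ᶜ → w #0
    *≈1⇒#0 z w e = invertibleˡ⇒# (normSq z , trans (*-congˡ (x-0≈x _))
      (trans (sym (normSq-* z w)) (trans (normSq-cong e)
        (solve 0 (con (+ 1) :* con (+ 1) :+ con (+ 0) :* con (+ 0) := con (+ 1))
          refl))))

    re>0⇒#0 : ∀ {z} → 0# < re z → z #0
    re>0⇒#0 {z} 0<x = 0<⇒#0 (<-≤-trans (*-pos 0<x 0<x)
      (sym (+-identityʳ _) ≈≤ +-monoʳ-≤ _ (square-nonneg (im z))))

    *ᶜ-cancelˡ : ∀ z → z #0 → ∀ v w → z *ᶜ v ≈ᶜ z *ᶜ w → v ≈ᶜ w
    *ᶜ-cancelˡ z z#0 v w e = begin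
      v                           ≈⟨ lemma v ⟩
      inverse z z#0 *ᶜ (z *ᶜ v)   ≈⟨ ℂ-Ring.*-congˡ {inverse z z#0} {z *ᶜ v} {z *ᶜ w} e ⟩
      inverse z z#0 *ᶜ (z *ᶜ w)   ≈⟨ lemma w ⟨
      w                           ∎
      where
      open SetoidReasoning ℂ-Ring.setoid
      lemma : ∀ v → v ≈ᶜ inverse z z#0 *ᶜ (z *ᶜ v)
      lemma v = begin
        v                           ≈⟨ ℂ-Ring.*-identityˡ v ⟨
        1ᶜ *ᶜ v                     ≈⟨ ℂ-Ring.*-congʳ {v} {z *ᶜ inverse z z#0} {1ᶜ} (*-inverseʳ z z#0) ⟨
        z *ᶜ inverse z z#0 *ᶜ v     ≈⟨ ℂ-Solver.solve 3 (λ z i v →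
                                        z ℂ-Solver.:* i ℂ-Solver.:* v
                                        ℂ-Solver.:= i ℂ-Solver.:* (z ℂ-Solver.:* v))
                                        ℂ-Ring.refl z (inverse z z#0) v ⟩
        inverse z z#0 *ᶜ (z *ᶜ v)   ∎

    2#0 : 2ᶜ #0
    2#0 = re>0⇒#0 (<-trans 0<1 (sym (+-identityˡ 1#) ≈< +-monoˡ-< 1# 0<1))

    *≈2⇒#0 : ∀ z w → z *ᶜ w ≈ᶜ 2ᶜ → w #0
    *≈2⇒#0 z w e = *≈1⇒#0 (inverse 2ᶜ 2#0 *ᶜ z) w (begin
      inverse 2ᶜ 2#0 *ᶜ z *ᶜ w     ≈⟨ ℂ-Ring.*-assoc _ z w ⟩
      inverse 2ᶜ 2#0 *ᶜ (z *ᶜ w)   ≈⟨ ℂ-Ring.*-congˡ {inverse 2ᶜ 2#0} {z *ᶜ w} {2ᶜ} e ⟩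
      inverse 2ᶜ 2#0 *ᶜ 2ᶜ         ≈⟨ ℂ-Ring.*-comm _ 2ᶜ ⟩
      2ᶜ *ᶜ inverse 2ᶜ 2#0         ≈⟨ *-inverseʳ 2ᶜ 2#0 ⟩
      1ᶜ                           ∎)
      where open SetoidReasoning ℂ-Ring.setoid

    record Convergesᶜ (s : ℕ → ℂ) (l : ℂ) : Set (c ⊔ ℓ₃) where
      constructor _,ᶜ_
      field
        re-converges : ConvergesTo (re ∘ s) (re l)
        im-converges : ConvergesTo (im ∘ s) (im l)

    open Convergesᶜ public

    convergesᶜ-unique : ∀ {s s′ l l′} → Convergesᶜ s l → Convergesᶜ s′ l′ →
      (∀ n → s n ≈ᶜ s′ n) → l ≈ᶜ l′
    convergesᶜ-unique (p ,ᶜ q) (p′ ,ᶜ q′) e =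
        converges-unique (proj₁ ∘ e) p p′ , converges-unique (proj₂ ∘ e) q q′

    convergesᶜ-cong : ∀ {s s′ l} → Convergesᶜ s l → (∀ n → s n ≈ᶜ s′ n) →
      Convergesᶜ s′ l
    convergesᶜ-cong (p ,ᶜ q) e =
      converges-cong (proj₁ ∘ e) refl p ,ᶜ converges-cong (proj₂ ∘ e) refl q

    convergesᶜ-resp-limit : ∀ {s l l′} → Convergesᶜ s l → l ≈ᶜ l′ →
      Convergesᶜ s l′
    convergesᶜ-resp-limit (p ,ᶜ q) (e₁ , e₂) =
      converges-cong (λ _ → refl) e₁ p ,ᶜ converges-cong (λ _ → refl) e₂ q

    convergesᶜ-+ : ∀ {s s′ l l′} → Convergesᶜ s l → Convergesᶜ s′ l′ →
      Convergesᶜ (λ n → s n +ᶜ s′ n) (l +ᶜ l′)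
    convergesᶜ-+ (p ,ᶜ q) (p′ ,ᶜ q′) = converges-+ p p′ ,ᶜ converges-+ q q′

    convergesᶜ-eventually-const : ∀ {s l} → (∀ n → s (suc n) ≈ᶜ l) →
      Convergesᶜ s l
    convergesᶜ-eventually-const e =
        converges-eventually-const (proj₁ ∘ e)
      ,ᶜ converges-eventually-const (proj₂ ∘ e)

    -- Each squared component of the error is at most its squared norm, so `square-cancel-<` removes
    -- the squares; using it for both signs of the difference gives both halves of `Within`.
    hasSum⇒converges : ∀ a s → HasSum a s → Convergesᶜ (partialSum a) s
    hasSum⇒converges a s h =
        (λ 0<ε → let N , close = h 0<ε in N , λ n N≤n →
          within 0<ε (≤-<-trans (≤+ (square-nonneg _)) (close n N≤n)))
      ,ᶜ (λ 0<ε → let N , close = h 0<ε in N , λ n N≤n →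
          within 0<ε (≤-<-trans (≤+ (square-nonneg _) ≤≈ +-comm _ _)
            (close n N≤n)))
      where
      ≤+ : ∀ {x y} → 0# ≤ y → x ≤ x + y
      ≤+ p = sym (+-identityʳ _) ≈≤ +-monoʳ-≤ _ p
      within : ∀ {x y ε} → 0# < ε → (x - y) * (x - y) < ε * ε → Within ε x y
      within {x} {y} {ε} 0<ε p =
          (0<-⇒< (<⇒0<- (square-cancel-< 0<ε p) <≈
            solve 3 (λ x y ε → ε :- (x :- y) := y :+ ε :- x) refl x y ε))
        , (0<-⇒< (<⇒0<- (square-cancel-< 0<ε (-x*-x (x - y) ≈< p)) <≈
            solve 3 (λ x y ε → ε :- :- (x :- y) := x :+ ε :- y) refl x y ε))

    partialSum-cong : ∀ {a b} → (∀ n → a n ≈ᶜ b n) →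
      ∀ n → partialSum a n ≈ᶜ partialSum b n
    partialSum-cong e zero    = refl , refl
    partialSum-cong e (suc n) =
      let p , q = partialSum-cong e n ; p′ , q′ = e n in +-cong p p′ , +-cong q q′

    partialSum-+ : ∀ a b n →
      partialSum a n +ᶜ partialSum b n ≈ᶜ partialSum (λ k → a k +ᶜ b k) n
    partialSum-+ a b zero    = +-identityˡ 0# , +-identityˡ 0#
    partialSum-+ a b (suc n) =
      let p , q = partialSum-+ a b n in
        trans (interchange _ _ _ _) (+-congʳ p)
      , trans (interchange _ _ _ _) (+-congʳ q)
      where
      interchange : ∀ x y z w → (x + y) + (z + w) ≈ (x + z) + (y + w)
      interchange = solve 4 (λ x y z w →
        (x :+ y) :+ (z :+ w) := (x :+ z) :+ (y :+ w)) refl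

    partialSum-head : ∀ a → (∀ k → a (suc k) ≈ᶜ 0ᶜ) →
      ∀ n → partialSum a (suc n) ≈ᶜ a 0
    partialSum-head a e zero    = +-identityˡ _ , +-identityˡ _
    partialSum-head a e (suc n) =
      let p , q = partialSum-head a e n ; p′ , q′ = e n in
        trans (+-cong p p′) (+-identityʳ _) , trans (+-cong q q′) (+-identityʳ _)

    •-cong : ∀ a {z w} → z ≈ᶜ w → a • z ≈ᶜ a • w
    •-cong a (p , q) = *-congˡ p , *-congˡ q

    ^ᶜ-cong : ∀ {z w} → z ≈ᶜ w → ∀ n → z ^ᶜ n ≈ᶜ w ^ᶜ n
    ^ᶜ-cong {z} {w} e n = ℂ-Exp.^-congˡ n {z} {w} e

    powOver!-cong : ∀ {z w} → z ≈ᶜ w → ∀ n → powOver! z n ≈ᶜ powOver! w n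
    powOver!-cong {z} {w} e n = •-cong (invFactorial n) (^ᶜ-cong {z} {w} e n)

    powOver!-0 : ∀ {z} → z ≈ᶜ 0ᶜ → ∀ n → powOver! z (suc n) ≈ᶜ 0ᶜ
    powOver!-0 {z} e n = let p , q = zero-pow in
      trans (*-congˡ p) (zeroʳ _) , trans (*-congˡ q) (zeroʳ _)
      where
      zero-pow : z ^ᶜ suc n ≈ᶜ 0ᶜ
      zero-pow = ℂ-Ring.trans {z ^ᶜ suc n} {0ᶜ *ᶜ (z ^ᶜ n)} {0ᶜ}
        (ℂ-Ring.*-congʳ {z ^ᶜ n} {z} {0ᶜ} e) (ℂ-Ring.zeroˡ (z ^ᶜ n))

    powOver!-zero : ∀ z → powOver! z 0 ≈ᶜ 1ᶜ
    powOver!-zero z = *-identityˡ 1# , zeroʳ 1#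

    ±1 : ℕ → ℂ
    ±1 n = (-ᶜ 1ᶜ) ^ᶜ n

    ±1-square : ∀ n → ±1 n *ᶜ ±1 n ≈ᶜ 1ᶜ
    ±1-square n = begin
      ±1 n *ᶜ ±1 n                 ≈⟨ ℂ-Exp.^-distrib-* (-ᶜ 1ᶜ) (-ᶜ 1ᶜ) n ⟨
      ((-ᶜ 1ᶜ) *ᶜ (-ᶜ 1ᶜ)) ^ᶜ n     ≈⟨ ^ᶜ-cong {(-ᶜ 1ᶜ) *ᶜ (-ᶜ 1ᶜ)} {1ᶜ} (ℂ-Solver.solve 0
                                       (ℂ-Solver.:- one ℂ-Solver.:* ℂ-Solver.:- one ℂ-Solver.:= one)
                                       ℂ-Ring.refl) n ⟩
      1ᶜ ^ᶜ n                      ≈⟨ 1^n n ⟩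
      1ᶜ                           ∎
      where
      open SetoidReasoning ℂ-Ring.setoid
      one : ∀ {n} → ℂ-Solver.Polynomial n
      one = ℂ-Solver.con (+ 1)
      1^n : ∀ n → 1ᶜ ^ᶜ n ≈ᶜ 1ᶜ
      1^n zero    = ℂ-Ring.refl {1ᶜ}
      1^n (suc n) = ℂ-Ring.trans {1ᶜ *ᶜ (1ᶜ ^ᶜ n)} {1ᶜ ^ᶜ n} {1ᶜ}
        (ℂ-Ring.*-identityˡ (1ᶜ ^ᶜ n)) (1^n n)

    powOver!-neg : ∀ z n → powOver! (-ᶜ z) n ≈ᶜ ±1 n *ᶜ powOver! z n
    powOver!-neg z n = begin
      powOver! (-ᶜ z) n                       ≈⟨ •-cong (invFactorial n) pow ⟩
      invFactorial n • (±1 n *ᶜ (z ^ᶜ n))     ≈⟨ •-*ᶜ (invFactorial n) (±1 n) (z ^ᶜ n) ⟩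
      ±1 n *ᶜ powOver! z n                    ∎
      where
      open SetoidReasoning ℂ-Ring.setoid
      pow : (-ᶜ z) ^ᶜ n ≈ᶜ ±1 n *ᶜ (z ^ᶜ n)
      pow = begin
        (-ᶜ z) ^ᶜ n           ≈⟨ ^ᶜ-cong { -ᶜ z} {(-ᶜ 1ᶜ) *ᶜ z} (ℂ-Solver.solve 1 (λ z →
                                 ℂ-Solver.:- z ℂ-Solver.:=
                                 ℂ-Solver.:- ℂ-Solver.con (+ 1) ℂ-Solver.:* z) ℂ-Ring.refl z) n ⟩
        ((-ᶜ 1ᶜ) *ᶜ z) ^ᶜ n   ≈⟨ ℂ-Exp.^-distrib-* (-ᶜ 1ᶜ) z n ⟩
        ±1 n *ᶜ (z ^ᶜ n)      ∎
      •-*ᶜ : ∀ a z w → a • (z *ᶜ w) ≈ᶜ z *ᶜ (a • w)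
      •-*ᶜ a (x +i x′) (y +i y′) =
          solve 5 (λ a x x′ y y′ → a :* (x :* y :- x′ :* y′)
            := x :* (a :* y) :- x′ :* (a :* y′)) refl a x x′ y y′
        , solve 5 (λ a x x′ y y′ → a :* (x :* y′ :+ x′ :* y)
            := x :* (a :* y′) :+ x′ :* (a :* y)) refl a x x′ y y′

    exp-converges : ∀ z → Convergesᶜ (partialSum (powOver! z)) (exp R z)
    exp-converges z = proj₂ (complete _ (ExpSeries.re-cauchy z))
                    ,ᶜ proj₂ (complete _ (ExpSeries.im-cauchy z))

    exp-cong : ∀ {z w} → z ≈ᶜ w → exp R z ≈ᶜ exp R w
    exp-cong {z} {w} e = convergesᶜ-unique (exp-converges z) (exp-converges w)
      (partialSum-cong (powOver!-cong {z} {w} e))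

    exp-0 : ∀ {z} → z ≈ᶜ 0ᶜ → exp R z ≈ᶜ 1ᶜ
    exp-0 {z} e = convergesᶜ-unique (exp-converges z)
      (convergesᶜ-eventually-const λ n → begin
        partialSum (powOver! z) (suc n)  ≈⟨ partialSum-head _ (powOver!-0 {z} e) n ⟩
        powOver! z 0                     ≈⟨ powOver!-zero z ⟩
        1ᶜ                               ∎)
      (λ _ → refl , refl)
      where open SetoidReasoning ℂ-Ring.setoid

    eval-cong : ∀ p {z w} → z ≈ᶜ w → eval p z ≈ᶜ eval p w
    eval-cong []      e = refl , refl
    eval-cong (a ∷ p) {z} {w} e = ℂ-Ring.+-congˡ {a}
      {z *ᶜ eval p z} {w *ᶜ eval p w}
      (ℂ-Ring.*-cong {z} {w} {eval p z} {eval p w} e (eval-cong p {z} {w} e))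

    -- Exponential generating series.

    series : (ℕ → ℂ) → ℂ → ℕ → ℂ
    series a t = partialSum (λ k → a k *ᶜ powOver! t k)

    -- Moving the signs into the coefficients is what turns a symmetry between `x = 0` and `x = 1`
    -- into one between `t` and `- t`.
    series-neg : ∀ a t n → series a (-ᶜ t) n ≈ᶜ series (λ k → ±1 k *ᶜ a k) t n
    series-neg a t = partialSum-cong λ k → begin
      a k *ᶜ powOver! (-ᶜ t) k        ≈⟨ ℂ-Ring.*-congˡ {a k} {powOver! (-ᶜ t) k} {±1 k *ᶜ powOver! t k} (powOver!-neg t k) ⟩
      a k *ᶜ (±1 k *ᶜ powOver! t k)   ≈⟨ ℂ-Solver.solve 3 (λ a s p →
                                           a ℂ-Solver.:* (s ℂ-Solver.:* p) ℂ-Solver.:=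
                                           s ℂ-Solver.:* a ℂ-Solver.:* p)
                                           ℂ-Ring.refl (a k) (±1 k) (powOver! t k) ⟩
      ±1 k *ᶜ a k *ᶜ powOver! t k     ∎
      where open SetoidReasoning ℂ-Ring.setoid

    series-cong : ∀ {a b} → (∀ k → a k ≈ᶜ b k) → ∀ t n → series a t n ≈ᶜ series b t n
    series-cong {a} {b} e t = partialSum-cong λ k →
      ℂ-Ring.*-congʳ {powOver! t k} {a k} {b k} (e k)

    series-+ : ∀ a b t n →
      series a t n +ᶜ series b t n ≈ᶜ series (λ k → a k +ᶜ b k) t n
    series-+ a b t n = begin
      series a t n +ᶜ series b t n  ≈⟨ partialSum-+ _ _ n ⟩
      partialSum (λ k → a k *ᶜ powOver! t k +ᶜ b k *ᶜ powOver! t k) n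
        ≈⟨ partialSum-cong (λ k → ℂ-Ring.distribʳ (powOver! t k) (a k) (b k)) n ⟨
      series (λ k → a k +ᶜ b k) t n  ∎
      where open SetoidReasoning ℂ-Ring.setoid

    series-head : ∀ a t → (∀ k → a (suc k) *ᶜ powOver! t (suc k) ≈ᶜ 0ᶜ) →
      ∀ n → series a t (suc n) ≈ᶜ a 0
    series-head a t e n = begin
      series a t (suc n)     ≈⟨ partialSum-head _ e n ⟩
      a 0 *ᶜ powOver! t 0    ≈⟨ ℂ-Ring.*-congˡ {a 0} {powOver! t 0} {1ᶜ} (powOver!-zero t) ⟩
      a 0 *ᶜ 1ᶜ              ≈⟨ ℂ-Ring.*-identityʳ (a 0) ⟩
      a 0                    ∎
      where open SetoidReasoning ℂ-Ring.setoid

    real : ℝ → ℂ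
    real x = x +i 0#

    real-in-disc : ∀ {x r} → 0# < x → x < r → ∣ real x ∣< r
    real-in-disc {x} {r} 0<x x<r =
      solve 1 (λ x → x :* x :+ con (+ 0) :* con (+ 0) := x :* x) refl x
      ≈< <-trans (*-monoˡ-< 0<x x<r)
           (*-comm r x ≈< *-monoˡ-< (<-trans 0<x x<r) x<r)

    powOver!-real : ∀ x n → powOver! (real x) n ≈ᶜ real (invFactorial n * x ^ n)
    powOver!-real x n = let p , q = pow n in
      *-congˡ p , trans (*-congˡ q) (zeroʳ (invFactorial n))
      where
      pow : ∀ n → real x ^ᶜ n ≈ᶜ real (x ^ n)
      pow zero    = refl , refl
      pow (suc n) = let p , q = pow n in
          trans (+-cong (*-congˡ p) (-‿cong (*-congˡ q)))
            (solve 2 (λ x y → x :* y :- con (+ 0) :* con (+ 0) := x :* y)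
              refl x (x ^ n))
        , trans (+-cong (*-congˡ q) (*-congˡ p))
            (solve 2 (λ x y → x :* con (+ 0) :+ con (+ 0) :* y := con (+ 0))
              refl x (x ^ n))

    -- At a real argument the powers are real, so each component of the series is a real power
    -- series with these coefficients.
    re-coeffs im-coeffs : (ℕ → ℂ) → ℕ → ℝ
    re-coeffs a k = re (a k) * invFactorial k
    im-coeffs a k = im (a k) * invFactorial k

    series-re : ∀ a x n → re (series a (real x) n) ≈ powerSum (re-coeffs a) x n
    series-re a x zero    = refl
    series-re a x (suc n) = let p , q = powOver!-real x n in
      +-cong (series-re a x n) (trans
        (+-cong (*-congˡ p) (-‿cong (*-congˡ q)))
        (solve 4 (λ a b i y → a :* (i :* y) :- b :* con (+ 0) := a :* i :* y)
          refl (re (a n)) (im (a n)) (invFactorial n) (x ^ n)))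

    series-im : ∀ a x n → im (series a (real x) n) ≈ powerSum (im-coeffs a) x n
    series-im a x zero    = refl
    series-im a x (suc n) = let p , q = powOver!-real x n in
      +-cong (series-im a x n) (trans
        (+-cong (*-congˡ q) (*-congˡ p))
        (solve 4 (λ a b i y → a :* con (+ 0) :+ b :* (i :* y) := b :* i :* y)
          refl (re (a n)) (im (a n)) (invFactorial n) (x ^ n)))

    invFactorial-cancel : ∀ n {x y} → x * invFactorial n ≈ y * invFactorial n →
      x ≈ y
    invFactorial-cancel n {x} {y} e =
      trans (lemma x) (trans (*-congʳ e) (sym (lemma y)))
      where
      n!#0 = 0<⇒#0 (invFactorial-pos n)
      lemma : ∀ x → x ≈ x * invFactorial n * recip (invFactorial n) n!#0
      lemma x = sym (trans (*-assoc x _ _)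
        (trans (*-congˡ (recip-inverseʳ _ n!#0)) (*-identityʳ x)))

    series-unique : ∀ {a b} →
      Near0 (λ x → ∃ λ l → Convergesᶜ (series a (real x)) l
                          × Convergesᶜ (series b (real x)) l) →
      ∀ n → a n ≈ᶜ b n
    series-unique {a} {b} h n =
        invFactorial-cancel n (powerSeries-unique (near-map h λ x _ (l , p , q) →
          re l , converges-cong (series-re a x) refl (re-converges p)
               , converges-cong (series-re b x) refl (re-converges q)) n)
      , invFactorial-cancel n (powerSeries-unique (near-map h λ x _ (l , p , q) →
          im l , converges-cong (series-im a x) refl (im-converges p)
               , converges-cong (series-im b x) refl (im-converges q)) n)

    -- Only the real part is tracked, because a positive real part already forces apartness from
    -- zero.
    series-near-head : ∀ a →
      Near0 (λ x → ∃ λ l → Convergesᶜ (series a (real x)) l) → ∀ {ε} → 0# < ε →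
      Near0 (λ x → ∀ n → Bounded (re (series a (real x) (suc n)) - re (a 0)) ε)
    series-near-head a h 0<ε = near-map
      (powerSum-near-head (re-coeffs a) (near-map h λ x _ (l , p) →
        re l , converges-cong (series-re a x) refl (re-converges p)) 0<ε)
      λ x _ bound n → bounded-cong
        (+-cong (sym (series-re a x (suc n))) (-‿cong (*-identityʳ (re (a 0)))))
        (bound n)

  -- Generating functions and reflection.

  module GeneratingFunctions where

    open RealField R using (_+_; 1#; _≈_; _≤_)
    open RealProperties R
    open RealAnalysis R
    open ComplexRing
    open ComplexAnalysis
    open CommutativeRing ℂ-ring
      using (setoid; refl; sym; trans; +-congˡ; +-congʳ; *-congˡ; *-congʳ; *-comm;
             *-assoc; *-identityˡ; *-identityʳ; zeroˡ; zeroʳ)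
    open IntegerCoefficients ℂ-ring
    open SetoidReasoning setoid
    private
      module ℝ-Ring = CommutativeRing (RealField.commutativeRing R)
      module ℝ-Solver = IntegerCoefficients (RealField.commutativeRing R)

    2≈1+1 : 2ᶜ ≈ᶜ 1ᶜ +ᶜ 1ᶜ
    2≈1+1 = ℝ-Ring.refl , ℝ-Ring.sym (ℝ-Ring.+-identityˡ 0#)

    coeffs-at : (ℕ → Poly) → ℂ → ℕ → ℂ
    coeffs-at P x n = eval (P n) x

    module _ (P : ℕ → Poly) {r : ℝ} (f : Disc r → ℂ)
             (gf : HasGeneratingFunction P f) where

      -- The argument of `exp` is taken up to `≈ᶜ`, so that `0ᶜ`, `t` or `- t` may stand for the
      -- product arising at `x = 0` or `x = 1`.
      gf-converges : ∀ x t w → w ≈ᶜ x *ᶜ proj₁ t →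
        Convergesᶜ (series (coeffs-at P x) (proj₁ t)) (f t *ᶜ exp R w)
      gf-converges x t w e = convergesᶜ-resp-limit
        (hasSum⇒converges (λ n → eval (P n) x *ᶜ powOver! (proj₁ t) n)
          (f t *ᶜ exp R (Complex._*ᶜ_ R x (proj₁ t))) (gf x t))
        (*-congˡ {f t} {exp R (Complex._*ᶜ_ R x (proj₁ t))} {exp R w}
          (exp-cong {Complex._*ᶜ_ R x (proj₁ t)} {w}
            (sym {w} {x *ᶜ proj₁ t} e)))

      gf-at-0 : ∀ t → Convergesᶜ (series (coeffs-at P 0ᶜ) (proj₁ t)) (f t)
      gf-at-0 t = convergesᶜ-resp-limit
        (gf-converges 0ᶜ t 0ᶜ (sym {0ᶜ *ᶜ proj₁ t} {0ᶜ} (zeroˡ (proj₁ t))))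
        (begin
          f t *ᶜ exp R 0ᶜ  ≈⟨ *-congˡ {f t} {exp R 0ᶜ} {1ᶜ} (exp-0 {0ᶜ} (refl {0ᶜ})) ⟩
          f t *ᶜ 1ᶜ        ≈⟨ *-identityʳ (f t) ⟩
          f t              ∎)

      gf-at-1 : ∀ t w → w ≈ᶜ proj₁ t →
        Convergesᶜ (series (coeffs-at P 1ᶜ) (proj₁ t)) (f t *ᶜ exp R w)
      gf-at-1 t w e = gf-converges 1ᶜ t w (begin
        w               ≈⟨ e ⟩
        proj₁ t         ≈⟨ *-identityˡ (proj₁ t) ⟨
        1ᶜ *ᶜ proj₁ t   ∎)

      module _ (reflect : ∀ n x →
        eval (P n) (1ᶜ -ᶜ x) ≈ᶜ ((-ᶜ 1ᶜ) ^ᶜ n) *ᶜ eval (P n) x) where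

        coeffs-reflect : ∀ n → eval (P n) 1ᶜ ≈ᶜ ±1 n *ᶜ eval (P n) 0ᶜ
        coeffs-reflect n = begin
          eval (P n) 1ᶜ          ≈⟨ eval-cong (P n) {1ᶜ} {1ᶜ -ᶜ 0ᶜ} (solve 0
                                      (con (+ 1) := con (+ 1) :- con (+ 0)) refl) ⟩
          eval (P n) (1ᶜ -ᶜ 0ᶜ)  ≈⟨ reflect n 0ᶜ ⟩
          ±1 n *ᶜ eval (P n) 0ᶜ  ∎

        -- At `x = 1` the coefficients are `(-1)^k P_k(0)`, so the series there at `t` is the series
        -- for `x = 0` at `- t`; both sides are its limit.
        gf-reflect : ∀ t → f t *ᶜ exp R (proj₁ t) ≈ᶜ f (-ᴰ t)
        gf-reflect t = convergesᶜ-unique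
          (gf-at-1 t (proj₁ t) (refl {proj₁ t})) (gf-at-0 (-ᴰ t)) λ n → begin
            series (coeffs-at P 1ᶜ) (proj₁ t) n
              ≈⟨ series-cong coeffs-reflect (proj₁ t) n ⟩
            series (λ k → ±1 k *ᶜ eval (P k) 0ᶜ) (proj₁ t) n
              ≈⟨ series-neg (coeffs-at P 0ᶜ) (proj₁ t) n ⟨
            series (coeffs-at P 0ᶜ) (-ᶜ proj₁ t) n ∎

        -- Reflection at `- t` would end in `f (-ᴰ (-ᴰ t))`, and `f` is not known to respect
        -- equality of points. The signs are undone in the coefficients instead.
        gf-reflect⁻ : ∀ t w → w ≈ᶜ -ᶜ proj₁ t → f (-ᴰ t) *ᶜ exp R w ≈ᶜ f t
        gf-reflect⁻ t w e = convergesᶜ-unique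
          (gf-at-1 (-ᴰ t) w e) (gf-at-0 t) (λ n → begin
            series (coeffs-at P 1ᶜ) (-ᶜ proj₁ t) n
              ≈⟨ series-neg (coeffs-at P 1ᶜ) (proj₁ t) n ⟩
            series (λ k → ±1 k *ᶜ eval (P k) 1ᶜ) (proj₁ t) n
              ≈⟨ series-cong undo (proj₁ t) n ⟩
            series (coeffs-at P 0ᶜ) (proj₁ t) n ∎)
          where
          undo : ∀ k → ±1 k *ᶜ eval (P k) 1ᶜ ≈ᶜ eval (P k) 0ᶜ
          undo k = begin
            ±1 k *ᶜ eval (P k) 1ᶜ
              ≈⟨ *-congˡ {±1 k} {eval (P k) 1ᶜ} {±1 k *ᶜ eval (P k) 0ᶜ}
                   (coeffs-reflect k) ⟩
            ±1 k *ᶜ (±1 k *ᶜ eval (P k) 0ᶜ)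
              ≈⟨ *-assoc (±1 k) (±1 k) (eval (P k) 0ᶜ) ⟨
            ±1 k *ᶜ ±1 k *ᶜ eval (P k) 0ᶜ
              ≈⟨ *-congʳ {eval (P k) 0ᶜ} {±1 k *ᶜ ±1 k} {1ᶜ} (±1-square k) ⟩
            1ᶜ *ᶜ eval (P k) 0ᶜ
              ≈⟨ *-identityˡ (eval (P k) 0ᶜ) ⟩
            eval (P k) 0ᶜ ∎

    2/z*z≈2 : ∀ z z#0 → 2ᶜ *ᶜ inverse z z#0 *ᶜ z ≈ᶜ 2ᶜ
    2/z*z≈2 z z#0 = begin
      2ᶜ *ᶜ inverse z z#0 *ᶜ z    ≈⟨ solve 3 (λ a i z → a :* i :* z := a :* (z :* i))
                                       refl 2ᶜ (inverse z z#0) z ⟩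
      2ᶜ *ᶜ (z *ᶜ inverse z z#0)  ≈⟨ *-congˡ {2ᶜ} {z *ᶜ inverse z z#0} {1ᶜ}
                                       (*-inverseʳ z z#0) ⟩
      2ᶜ *ᶜ 1ᶜ                    ≈⟨ *-identityʳ 2ᶜ ⟩
      2ᶜ                          ∎

    -- Values of the Euler polynomials at 0 and 1.

    module Euler (E : ℕ → Poly) {ρ : ℝ} (0<ρ : 0# < ρ)
      (eᵗ+1#0 : (t : Disc ρ) → (exp R (proj₁ t) +ᶜ 1ᶜ) #0)
      (g : Disc ρ → ℂ) (g-gf : HasGeneratingFunction E g)
      -- The quotient `2 / (e^t + 1)` enters through this product relation, which keeps explicit
      -- inverses out of the work with series.
      (g*[eᵗ+1]≈2 : ∀ t → g t *ᶜ (exp R (proj₁ t) +ᶜ 1ᶜ) ≈ᶜ 2ᶜ)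
      where

      e₀ : ℂ
      e₀ = eval (E 0) 0ᶜ

      -- At `t = 0` the series collapses to its head, so `g(0) = e₀`, and `g(0) (e^0 + 1) = 2` reads
      -- `e₀ * 2 = 2`.
      e₀≈1 : e₀ ≈ᶜ 1ᶜ
      e₀≈1 = at-centre (centre 0<ρ) (refl {0ᶜ})
        where
        at-centre : ∀ (t : Disc ρ) → proj₁ t ≈ᶜ 0ᶜ → e₀ ≈ᶜ 1ᶜ
        at-centre t t≈0 = *ᶜ-cancelˡ 2ᶜ 2#0 e₀ 1ᶜ (begin
          2ᶜ *ᶜ e₀                        ≈⟨ *-comm 2ᶜ e₀ ⟩
          e₀ *ᶜ 2ᶜ                        ≈⟨ *-congˡ {e₀} {2ᶜ} {exp R (proj₁ t) +ᶜ 1ᶜ} 2≈eᵗ+1 ⟩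
          e₀ *ᶜ (exp R (proj₁ t) +ᶜ 1ᶜ)   ≈⟨ *-congʳ {exp R (proj₁ t) +ᶜ 1ᶜ} {e₀} {g t} e₀≈g ⟩
          g t *ᶜ (exp R (proj₁ t) +ᶜ 1ᶜ)  ≈⟨ g*[eᵗ+1]≈2 t ⟩
          2ᶜ                              ≈⟨ *-identityʳ 2ᶜ ⟨
          2ᶜ *ᶜ 1ᶜ                        ∎)
          where
          2≈eᵗ+1 : 2ᶜ ≈ᶜ exp R (proj₁ t) +ᶜ 1ᶜ
          2≈eᵗ+1 = begin
            2ᶜ                      ≈⟨ 2≈1+1 ⟩
            1ᶜ +ᶜ 1ᶜ                ≈⟨ +-congʳ {1ᶜ} {exp R (proj₁ t)} {1ᶜ} (exp-0 {proj₁ t} t≈0) ⟨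
            exp R (proj₁ t) +ᶜ 1ᶜ   ∎
          e₀≈g : e₀ ≈ᶜ g t
          e₀≈g = convergesᶜ-unique
            (convergesᶜ-eventually-const
              (series-head (coeffs-at E 0ᶜ) (proj₁ t) λ k → begin
                eval (E (suc k)) 0ᶜ *ᶜ powOver! (proj₁ t) (suc k)
                  ≈⟨ *-congˡ {eval (E (suc k)) 0ᶜ} {powOver! (proj₁ t) (suc k)} {0ᶜ}
                       (powOver!-0 {proj₁ t} t≈0 k) ⟩
                eval (E (suc k)) 0ᶜ *ᶜ 0ᶜ
                  ≈⟨ zeroʳ (eval (E (suc k)) 0ᶜ) ⟩
                0ᶜ ∎))
            (gf-at-0 E g g-gf t)
            (λ n → refl {series (coeffs-at E 0ᶜ) (proj₁ t) n})

      2δ : ℕ → ℂ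
      2δ zero    = 2ᶜ
      2δ (suc n) = 0ᶜ

      series-2δ : ∀ t n → series 2δ t (suc n) ≈ᶜ 2ᶜ
      series-2δ t = series-head 2δ t λ k → zeroˡ (powOver! t (suc k))

      E-sum-converges : ∀ t →
        Convergesᶜ (series (λ k → eval (E k) 0ᶜ +ᶜ eval (E k) 1ᶜ) (proj₁ t)) 2ᶜ
      E-sum-converges t = convergesᶜ-resp-limit
          (convergesᶜ-cong
            (convergesᶜ-+ (gf-at-0 E g g-gf t)
              (gf-at-1 E g g-gf t (proj₁ t) (refl {proj₁ t})))
            (series-+ (coeffs-at E 0ᶜ) (coeffs-at E 1ᶜ) (proj₁ t)))
          (combine (g t) (exp R (proj₁ t)) (g*[eᵗ+1]≈2 t))
        where
        combine : ∀ G e → G *ᶜ (e +ᶜ 1ᶜ) ≈ᶜ 2ᶜ → G +ᶜ G *ᶜ e ≈ᶜ 2ᶜ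
        combine G e p = begin
          G +ᶜ G *ᶜ e     ≈⟨ solve 2 (λ G e → G :+ G :* e
                               := G :* (e :+ con (+ 1))) refl G e ⟩
          G *ᶜ (e +ᶜ 1ᶜ)  ≈⟨ p ⟩
          2ᶜ              ∎

      -- The two series add up to `g + g e^t = 2`, and `2δ` lists the coefficients of the constant
      -- 2.
      E-sum : ∀ n → eval (E n) 0ᶜ +ᶜ eval (E n) 1ᶜ ≈ᶜ 2δ n
      E-sum = series-unique (near-map (near-below 0<ρ) λ x 0<x x<ρ →
        2ᶜ , E-sum-converges (real x , real-in-disc 0<x x<ρ)
           , convergesᶜ-eventually-const (series-2δ (real x)))

      -- A reflected generating function with odd remainder.

      module Perturbed (P : ℕ → Poly) {r : ℝ} (r>0 : 0# < r) (f : Disc r → ℂ)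
        (gf : HasGeneratingFunction P f)
        (reflect : ∀ n x →
          eval (P n) (1ᶜ -ᶜ x) ≈ᶜ ((-ᶜ 1ᶜ) ^ᶜ n) *ᶜ eval (P n) x)
        (N : ℕ)
        (odd : Odd (λ t → f t -ᶜ series (coeffs-at E 0ᶜ) (proj₁ t) (suc N)))
        where

        S A : ℂ → ℂ
        S t = series (coeffs-at E 0ᶜ) t (suc N)
        A t = S t +ᶜ S (-ᶜ t)

        f*[eᵗ+1]≈A : ∀ t → f t *ᶜ (exp R (proj₁ t) +ᶜ 1ᶜ) ≈ᶜ A (proj₁ t)
        f*[eᵗ+1]≈A t = combine (f t) (f (-ᴰ t)) (exp R (proj₁ t)) (S (proj₁ t))
            (S (-ᶜ proj₁ t)) (gf-reflect P f gf reflect t) (odd t)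
          where
          combine : ∀ F F′ e s s′ → F *ᶜ e ≈ᶜ F′ → F′ -ᶜ s′ ≈ᶜ -ᶜ (F -ᶜ s) →
            F *ᶜ (e +ᶜ 1ᶜ) ≈ᶜ s +ᶜ s′
          combine F F′ e s s′ p q = begin
            F *ᶜ (e +ᶜ 1ᶜ)               ≈⟨ solve 2 (λ F e → F :* (e :+ con (+ 1))
                                              := F :* e :+ F) refl F e ⟩
            F *ᶜ e +ᶜ F                  ≈⟨ +-congʳ {F} {F *ᶜ e} {F′} p ⟩
            F′ +ᶜ F                      ≈⟨ solve 3 (λ F F′ s′ → F′ :+ F
                                              := (F′ :- s′) :+ (F :+ s′)) refl F F′ s′ ⟩
            (F′ -ᶜ s′) +ᶜ (F +ᶜ s′)      ≈⟨ +-congʳ {F +ᶜ s′} {F′ -ᶜ s′} { -ᶜ (F -ᶜ s)} q ⟩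
            (-ᶜ (F -ᶜ s)) +ᶜ (F +ᶜ s′)   ≈⟨ solve 3 (λ F s s′ → :- (F :- s) :+ (F :+ s′)
                                              := s :+ s′) refl F s s′ ⟩
            s +ᶜ s′                      ∎

        ±E : ℕ → ℂ
        ±E k = ±1 k *ᶜ eval (E k) 0ᶜ

        S⁻-converges : ∀ t → Convergesᶜ (series ±E (proj₁ t)) (g (-ᴰ t))
        S⁻-converges t = convergesᶜ-cong (gf-at-0 E g g-gf (-ᴰ t))
          (series-neg (coeffs-at E 0ᶜ) (proj₁ t))

        -- The truncation is estimated through the convergent full series: for small `x` every
        -- nonempty partial sum has real part within `ε = 1/2` of 1.
        near-head : ∀ a → a 0 ≈ᶜ 1ᶜ →
          Near0 (λ x → ∃ λ l → Convergesᶜ (series a (real x)) l) →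
          ∀ {ε} → 0# < ε → ε + ε ≈ 1# →
          Near0 (λ x → ε ≤ re (series a (real x) (suc N)))
        near-head a a₀≈1 conv {ε} 0<ε 2ε≈1 =
          near-map (series-near-head a conv 0<ε) λ x _ bound → 0≤-⇒≤ (≤⇒0≤- (proj₂ (bound N)) ≤≈
            ℝ-Ring.trans
              (ℝ-Solver.solve 3 (λ ε y a →
                 ε ℝ-Solver.:- ℝ-Solver.:- (y ℝ-Solver.:- a) ℝ-Solver.:=
                 y ℝ-Solver.:- ε ℝ-Solver.:+ (ε ℝ-Solver.:+ ε ℝ-Solver.:- a))
                 ℝ-Ring.refl ε (re (series a (real x) (suc N))) (re (a 0)))
              (ℝ-Ring.trans (ℝ-Ring.+-congˡ (ℝ-Ring.trans
                (ℝ-Ring.+-cong 2ε≈1 (ℝ-Ring.-‿cong (proj₁ a₀≈1)))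
                (ℝ-Ring.-‿inverseʳ 1#))) (ℝ-Ring.+-identityʳ _)))

        -- The real parts of `S(x)` and `S(-x)` are each at least 1/2, so that of `A(x)` is at least
        -- 1.
        A#0-near-0 : Near0 (λ x → A (real x) #0)
        A#0-near-0 = let ε , 0<ε , 2ε≈1 = half 0<1 in
          near-map
            (near-∩ (near-head (coeffs-at E 0ᶜ) e₀≈1 S-near 0<ε 2ε≈1)
                    (near-head ±E ±e₀≈1 S⁻-near 0<ε 2ε≈1))
            λ x _ (p , q) → re>0⇒#0 (<-≤-trans (0<1 <≈ ℝ-Ring.sym 2ε≈1)
              (+-mono-≤ p (q ≤≈ ℝ-Ring.sym
                (proj₁ (series-neg (coeffs-at E 0ᶜ) (real x) (suc N))))))
          where
          ±e₀≈1 : 1ᶜ *ᶜ e₀ ≈ᶜ 1ᶜ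
          ±e₀≈1 = trans {1ᶜ *ᶜ e₀} {e₀} {1ᶜ} (*-identityˡ e₀) e₀≈1
          S-near : Near0 (λ x → ∃ λ l →
            Convergesᶜ (series (coeffs-at E 0ᶜ) (real x)) l)
          S-near = near-map (near-below 0<ρ) λ x 0<x x<ρ →
            let t = real x , real-in-disc 0<x x<ρ in g t , gf-at-0 E g g-gf t
          S⁻-near : Near0 (λ x → ∃ λ l → Convergesᶜ (series ±E (real x)) l)
          S⁻-near = near-map (near-below 0<ρ) λ x 0<x x<ρ →
            let t = real x , real-in-disc 0<x x<ρ in g (-ᴰ t) , S⁻-converges t

        -- Cancelling requires apartness from zero. The factor `e^t + 1` replaces `f(t)`, for which
        -- this is not at hand, by `A(t)`, for which it is.
        exp-inverse : ∀ (t : Disc r) → A (proj₁ t) #0 →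
          ∀ w → w ≈ᶜ -ᶜ proj₁ t → exp R (proj₁ t) *ᶜ exp R w ≈ᶜ 1ᶜ
        exp-inverse t A#0 w e = cancel (f t) (f (-ᴰ t)) (exp R (proj₁ t))
            (exp R w) (A (proj₁ t)) A#0
            (gf-reflect P f gf reflect t) (gf-reflect⁻ P f gf reflect t w e) (f*[eᵗ+1]≈A t)
          where
          cancel : ∀ F F′ e e′ a → a #0 → F *ᶜ e ≈ᶜ F′ → F′ *ᶜ e′ ≈ᶜ F →
            F *ᶜ (e +ᶜ 1ᶜ) ≈ᶜ a → e *ᶜ e′ ≈ᶜ 1ᶜ
          cancel F F′ e e′ a a#0 p q s = *ᶜ-cancelˡ a a#0 (e *ᶜ e′) 1ᶜ (begin
            a *ᶜ (e *ᶜ e′)                 ≈⟨ *-congʳ {e *ᶜ e′} {F *ᶜ (e +ᶜ 1ᶜ)} {a} s ⟨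
            F *ᶜ (e +ᶜ 1ᶜ) *ᶜ (e *ᶜ e′)    ≈⟨ solve 3 (λ F e e′ →
                                                F :* (e :+ con (+ 1)) :* (e :* e′)
                                                := (F :* e) :* (e′ :* (e :+ con (+ 1))))
                                                refl F e e′ ⟩
            F *ᶜ e *ᶜ (e′ *ᶜ (e +ᶜ 1ᶜ))    ≈⟨ *-congʳ {e′ *ᶜ (e +ᶜ 1ᶜ)} {F *ᶜ e} {F′} p ⟩
            F′ *ᶜ (e′ *ᶜ (e +ᶜ 1ᶜ))        ≈⟨ *-assoc F′ e′ (e +ᶜ 1ᶜ) ⟨
            F′ *ᶜ e′ *ᶜ (e +ᶜ 1ᶜ)          ≈⟨ *-congʳ {e +ᶜ 1ᶜ} {F′ *ᶜ e′} {F} q ⟩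
            F *ᶜ (e +ᶜ 1ᶜ)                 ≈⟨ s ⟩
            a                              ≈⟨ *-identityʳ a ⟨
            a *ᶜ 1ᶜ                        ∎)

        -- Both sides times `e^s + 1` are 2, because `e^t (e^s + 1) = e^t + 1`.
        g-reflect : ∀ (t s : Disc ρ) →
          exp R (proj₁ t) *ᶜ exp R (proj₁ s) ≈ᶜ 1ᶜ →
          g t *ᶜ exp R (proj₁ t) ≈ᶜ g s
        g-reflect t s ee′≈1 = cancel (g t) (g s) (exp R (proj₁ t))
            (exp R (proj₁ s)) (eᵗ+1#0 s) (g*[eᵗ+1]≈2 t) (g*[eᵗ+1]≈2 s) ee′≈1
          where
          cancel : ∀ G G′ e e′ → (e′ +ᶜ 1ᶜ) #0 → G *ᶜ (e +ᶜ 1ᶜ) ≈ᶜ 2ᶜ →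
            G′ *ᶜ (e′ +ᶜ 1ᶜ) ≈ᶜ 2ᶜ → e *ᶜ e′ ≈ᶜ 1ᶜ → G *ᶜ e ≈ᶜ G′
          cancel G G′ e e′ #0 p q s = *ᶜ-cancelˡ (e′ +ᶜ 1ᶜ) #0 (G *ᶜ e) G′ (begin
            (e′ +ᶜ 1ᶜ) *ᶜ (G *ᶜ e)      ≈⟨ solve 3 (λ G e e′ →
                                             (e′ :+ con (+ 1)) :* (G :* e)
                                             := G :* (e :+ e :* e′)) refl G e e′ ⟩
            G *ᶜ (e +ᶜ e *ᶜ e′)         ≈⟨ *-congˡ {G} {e +ᶜ e *ᶜ e′} {e +ᶜ 1ᶜ}
                                             (+-congˡ {e} {e *ᶜ e′} {1ᶜ} s) ⟩
            G *ᶜ (e +ᶜ 1ᶜ)              ≈⟨ p ⟩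
            2ᶜ                          ≈⟨ q ⟨
            G′ *ᶜ (e′ +ᶜ 1ᶜ)            ≈⟨ *-comm G′ (e′ +ᶜ 1ᶜ) ⟩
            (e′ +ᶜ 1ᶜ) *ᶜ G′            ∎)

        E-reflect-converges : ∀ (t s : Disc ρ) → proj₁ s ≈ᶜ -ᶜ proj₁ t →
          ∣ proj₁ t ∣< r → A (proj₁ t) #0 →
          Convergesᶜ (series ±E (proj₁ t)) (g s) →
          Convergesᶜ (series ±E (proj₁ t)) (g t *ᶜ exp R (proj₁ t))
        E-reflect-converges t s s≈-t t<r A#0 conv = convergesᶜ-resp-limit conv
          (sym {g t *ᶜ exp R (proj₁ t)} {g s} (g-reflect t s
            (exp-inverse (proj₁ t , t<r) A#0 (proj₁ s) s≈-t)))

        E-reflect : ∀ n → eval (E n) 1ᶜ ≈ᶜ ±1 n *ᶜ eval (E n) 0ᶜ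
        E-reflect = series-unique (near-map
          -- The point has to lie in both discs: in that of `f` for `e^x e^(-x) = 1`, in that of `g`
          -- for the series.
          (near-∩ A#0-near-0 (near-∩ (near-below r>0) (near-below 0<ρ)))
          λ x 0<x (A#0 , x<r , x<ρ) →
            let t = real x , real-in-disc 0<x x<ρ in
              g t *ᶜ exp R (real x)
            , gf-at-1 E g g-gf t (real x) (refl {real x})
            , E-reflect-converges t (-ᴰ t) (refl { -ᶜ real x})
                (real-in-disc 0<x x<r) A#0 (S⁻-converges t))

        -- The coefficients `E_k(0) + (-1)^k E_k(0) = E_k(0) + E_k(1)` vanish one by one for
        -- `k > 0`, so truncating after index `N` is harmless and no bound on `t` enters.
        A≈2 : ∀ t → A t ≈ᶜ 2ᶜ
        A≈2 t = begin
          S t +ᶜ S (-ᶜ t)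
            ≈⟨ +-congˡ {S t} {S (-ᶜ t)} {series ±E t (suc N)}
                 (series-neg (coeffs-at E 0ᶜ) t (suc N)) ⟩
          S t +ᶜ series ±E t (suc N)
            ≈⟨ series-+ (coeffs-at E 0ᶜ) ±E t (suc N) ⟩
          series (λ k → eval (E k) 0ᶜ +ᶜ ±E k) t (suc N)
            ≈⟨ series-cong even-part t (suc N) ⟩
          series 2δ t (suc N)
            ≈⟨ series-2δ t N ⟩
          2ᶜ ∎
          where
          even-part : ∀ k → eval (E k) 0ᶜ +ᶜ ±E k ≈ᶜ 2δ k
          even-part k = begin
            eval (E k) 0ᶜ +ᶜ ±E k           ≈⟨ +-congˡ {eval (E k) 0ᶜ} {eval (E k) 1ᶜ} {±E k}
                                                 (E-reflect k) ⟨
            eval (E k) 0ᶜ +ᶜ eval (E k) 1ᶜ  ≈⟨ E-sum k ⟩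
            2δ k                            ∎

        f*[eᵗ+1]≈2 : ∀ t → f t *ᶜ (exp R (proj₁ t) +ᶜ 1ᶜ) ≈ᶜ 2ᶜ
        f*[eᵗ+1]≈2 t = trans {f t *ᶜ (exp R (proj₁ t) +ᶜ 1ᶜ)} {A (proj₁ t)} {2ᶜ}
          (f*[eᵗ+1]≈A t) (A≈2 (proj₁ t))

        -- Apartness of `e^t + 1` from zero on all of `Disc r` is itself a conclusion: a factor of
        -- the invertible number 2 is invertible.
        f-formula : ∀ t → Σ ((exp R (proj₁ t) +ᶜ 1ᶜ) #0) λ #0 →
          f t ≈ᶜ 2ᶜ *ᶜ inverse (exp R (proj₁ t) +ᶜ 1ᶜ) #0
        f-formula t = #0 , divide (f t) (exp R (proj₁ t) +ᶜ 1ᶜ) #0 (f*[eᵗ+1]≈2 t)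
          where
          #0 = *≈2⇒#0 (f t) (exp R (proj₁ t) +ᶜ 1ᶜ) (f*[eᵗ+1]≈2 t)
          divide : ∀ F z z#0 → F *ᶜ z ≈ᶜ 2ᶜ → F ≈ᶜ 2ᶜ *ᶜ inverse z z#0
          divide F z z#0 p = begin
            F                           ≈⟨ *-identityʳ F ⟨
            F *ᶜ 1ᶜ                     ≈⟨ *-congˡ {F} {z *ᶜ inverse z z#0} {1ᶜ}
                                             (*-inverseʳ z z#0) ⟨
            F *ᶜ (z *ᶜ inverse z z#0)   ≈⟨ *-assoc F z (inverse z z#0) ⟨
            F *ᶜ z *ᶜ inverse z z#0     ≈⟨ *-congʳ {inverse z z#0} {F *ᶜ z} {2ᶜ} p ⟩
            2ᶜ *ᶜ inverse z z#0         ∎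

        f≈g : ∀ (t : Disc r) (t<ρ : ∣ proj₁ t ∣< ρ) → f t ≈ᶜ g (proj₁ t , t<ρ)
        f≈g t t<ρ = cancel (f t) (g (proj₁ t , t<ρ))
            (exp R (proj₁ t) +ᶜ 1ᶜ) (eᵗ+1#0 (proj₁ t , t<ρ))
            (f*[eᵗ+1]≈2 t) (g*[eᵗ+1]≈2 (proj₁ t , t<ρ))
          where
          cancel : ∀ F G w → w #0 → F *ᶜ w ≈ᶜ 2ᶜ → G *ᶜ w ≈ᶜ 2ᶜ → F ≈ᶜ G
          cancel F G w w#0 p q = *ᶜ-cancelˡ w w#0 F G (begin
            w *ᶜ F   ≈⟨ *-comm w F ⟩
            F *ᶜ w   ≈⟨ p ⟩
            2ᶜ       ≈⟨ q ⟨
            G *ᶜ w   ≈⟨ *-comm G w ⟩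
            w *ᶜ G   ∎)

        -- For fixed `z` the factor `e^(z t)` is common, so `f = g` at small `t` gives both series
        -- the same limit.
        P≈E : ∀ n z → eval (P n) z ≈ᶜ eval (E n) z
        P≈E n z = series-unique (near-map
          (near-∩ (near-below r>0) (near-below 0<ρ))
          λ x 0<x (x<r , x<ρ) → common-sum
            (real x , real-in-disc 0<x x<r) (real-in-disc 0<x x<ρ)) n
          where
          common-sum : ∀ (t : Disc r) → ∣ proj₁ t ∣< ρ → ∃ λ l →
            Convergesᶜ (series (coeffs-at P z) (proj₁ t)) l ×
            Convergesᶜ (series (coeffs-at E z) (proj₁ t)) l
          common-sum t t<ρ = let s = proj₁ t , t<ρ ; w = z *ᶜ proj₁ t in
              g s *ᶜ exp R w
            , convergesᶜ-resp-limit (gf-converges P f gf z t w (refl {w}))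
                (*-congʳ {exp R w} {f t} {g s} (f≈g t t<ρ))
            , gf-converges E g g-gf z s w (refl {w})

open import Data.Nat.Base using (_≤_)

mainTheorem6 : ∀ {c ℓ₁ ℓ₂ ℓ₃} (R : RealField c ℓ₁ ℓ₂ ℓ₃) →
    let open Complex R in
    (E : ℕ → Poly) → IsEuler E →
    (P : ℕ → Poly) (r : ℝ) (r>0 : 0# < r) (f : Disc r → ℂ) →
    Holomorphic f →
    ¬ (f (centre r>0) ≈ᶜ 0ᶜ) →
    HasGeneratingFunction P f →
    (∀ n x → eval (P n) (1ᶜ -ᶜ x) ≈ᶜ ((-ᶜ 1ᶜ) ^ᶜ n) *ᶜ eval (P n) x) →
    (N : ℕ) → 1 ≤ N →
    Odd (λ t → f t -ᶜ
    partialSum (λ k → eval (E k) 0ᶜ *ᶜ powOver! (proj₁ t) k) (suc N)) →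
    (∀ n x → eval (P n) x ≈ᶜ eval (E n) x) ×
    (∀ t → Σ ((exp (proj₁ t) +ᶜ 1ᶜ) #0) λ eᵗ+1#0 →
    f t ≈ᶜ 2ᶜ *ᶜ inverse (exp (proj₁ t) +ᶜ 1ᶜ) eᵗ+1#0)
mainTheorem6 R E (ρ , 0<ρ , eᵗ+1#0 , g-gf) P r r>0 f _ _ gf reflect N _ odd =
  P≈E , f-formula
  where
  open ComplexNumbers R
  open GeneratingFunctions
  open Complex using (exp)
  open Complex R hiding (exp)
  open Euler E 0<ρ eᵗ+1#0
    (λ t → 2ᶜ *ᶜ inverse (exp R (proj₁ t) +ᶜ 1ᶜ) (eᵗ+1#0 t)) g-gf
    (λ t → 2/z*z≈2 (exp R (proj₁ t) +ᶜ 1ᶜ) (eᵗ+1#0 t))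
  open Perturbed P r>0 f gf reflect N odd
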